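{- Let $G(q)$ and $H(q)$ be the Rogers--Ramanujan functions. Then $$G(q)=\frac{1}{(q^5;q^5)_\infty}\sum_{n=0}^\infty\mathrm{cp}_{1,4,5}(n)q^n \qquad\text{and}\qquad H(q)=\frac{1}{(q^5;q^5)_\infty}\sum_{n=0}^\infty\mathrm{cp}_{2,3,5}(n)q^n.$$
   Context: Notation: $(A;Q)_n=\prod_{k=0}^{n-1}(1-AQ^k)$ and $(A;Q)_\infty=\prod_{k=0}^{\infty}(1-AQ^k)$, for $|Q|<1$ or as formal power series. The Rogers--Ramanujan functions are $$G(q):=\sum_{n=0}^\infty\frac{q^{n^2}}{(q;q)_n}=\frac{1}{(q;q^5)_\infty(q^4;q^5)_\infty},\qquad H(q):=\sum_{n=0}^\infty \frac{q^{n^2+n}}{(q;q)_n}=\frac{1}{(q^2;q^5)_\infty(q^3;q^5)_\infty},$$ where the equalities of sum and product are the classical Rogers--Ramanujan identities. A partition is a finite multiset of positive integers (its parts), possibly empty; its size $|\lambda|$ is the sum of its parts. For integers $a,b,m\ge 1$, an $(a,b,m)$-copartition is a triple of partitions $(\gamma,\rho,\sigma)$ such that each part of $\gamma$ is at least $a$ and congruent to $a \pmod m$, each part of $\sigma$ is at least $b$ and congruent to $b\pmod m$, and $\rho$ has the same number of parts as $\sigma$, each of which has size equal to $m$ times the number of parts of $\gamma$ (if $\gamma$ is empty, $\rho$ is regarded as empty). Its size is $|\gamma|+|\rho|+|\sigma|$. Let $\mathrm{cp}_{a,b,m}(n)$ denote the number of $(a,b,m)$-copartitions of size $n$. -}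

module Defs where

open import Data.Fin using (Fin)
open import Data.Integer as ℤ using (ℤ; +_; 0ℤ; 1ℤ)
import Data.Integer.Properties as ℤₚ
open import Data.List using (List; []; _∷_; length; sum; filter; lookup; applyUpTo; cartesianProduct; cartesianProductWith)
open import Data.List.Membership.Propositional using (_∈_)
open import Data.List.Membership.Propositional.Properties using (∈-lookup; ∈-filter⁺; ∈-filter⁻; ∈-applyUpTo⁺; ∈-cartesianProduct⁺; ∈-cartesianProductWith⁺)
import Data.List.Properties as Listₚ
open import Data.List.Relation.Unary.All as All using (All; []; _∷_; all?)
open import Data.List.Relation.Unary.All.Properties using (map⁺; ++⁺)
open import Data.List.Relation.Unary.AllPairs using ([]; _∷_)
open import Data.List.Relation.Unary.Any using (here; there; index)
open import Data.List.Relation.Unary.Any.Properties using (lookup-index)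
open import Data.List.Relation.Unary.Linked as Linked using (Linked; linked?)
open import Data.List.Relation.Unary.Unique.Propositional using (Unique)
import Data.List.Relation.Unary.Unique.Propositional.Properties as Uniqueₚ
open import Data.Nat as ℕ using (ℕ; zero; suc; _≤_; _<_; _≥_; z≤n; s≤s; _%_; NonZero)
import Data.Nat.Properties as ℕₚ
open import Data.Product using (Σ; _×_; _,_; proj₁; proj₂)
open import Function.Bundles using (_↔_; mk↔ₛ′)
open import Relation.Binary.PropositionalEquality using (_≡_; _≢_; _≗_; refl; sym; trans; cong; cong₂)
open import Relation.Nullary using (Dec; Irrelevant)
open import Relation.Nullary.Decidable using (_×-dec_)

-- Formal power series over ℤ, as coefficient sequences; two series are
-- equal when they agree pointwise (_≗_).

Series : Set
Series = ℕ → ℤ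

infixl 6 _⊖_
infixl 7 _⊛_
infixr 8 _↑_

-- Σ≤ n t = t 0 + … + t n
Σ≤ : ℕ → (ℕ → ℤ) → ℤ
Σ≤ zero    t = t 0
Σ≤ (suc n) t = t 0 ℤ.+ Σ≤ n (λ k → t (suc k))

one : Series
one zero    = 1ℤ
one (suc _) = 0ℤ

q : Series
q (suc zero) = 1ℤ
q _          = 0ℤ

_⊖_ : Series → Series → Series
(f ⊖ g) n = f n ℤ.- g n

_⊛_ : Series → Series → Series
(f ⊛ g) n = Σ≤ n (λ k → f k ℤ.* g (n ℕ.∸ k))

_↑_ : Series → ℕ → Series
f ↑ zero  = one
f ↑ suc k = f ⊛ (f ↑ k)

-- The reciprocal g of a series f with constant term 1 is determined by
-- g 0 = 1 and g (n + 1) = - (f 1 * g n + … + f (n + 1) * g 0).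
-- recipCoeffs f n lists g n, …, g 0.
dot : Series → List ℤ → ℤ
dot f []       = 0ℤ
dot f (x ∷ xs) = f 0 ℤ.* x ℤ.+ dot (λ k → f (suc k)) xs

recipStep : Series → List ℤ → ℤ
recipStep f xs = ℤ.- dot (λ k → f (suc k)) xs

recipCoeffs : Series → ℕ → List ℤ
recipCoeffs f zero    = 1ℤ ∷ []
recipCoeffs f (suc n) = recipStep f (recipCoeffs f n) ∷ recipCoeffs f n

recip : Series → Series
recip f zero    = 1ℤ
recip f (suc n) = recipStep f (recipCoeffs f n)

dot-recipCoeffs : ∀ f h n → dot h (recipCoeffs f n) ≡ (h ⊛ recip f) n
dot-recipCoeffs f h zero    = ℤₚ.+-identityʳ _
dot-recipCoeffs f h (suc n) =
  cong (λ z → h 0 ℤ.* recip f (suc n) ℤ.+ z) (dot-recipCoeffs f (λ k → h (suc k)) n)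

recip-inverse : ∀ f → f 0 ≡ 1ℤ → f ⊛ recip f ≗ one
recip-inverse f f0≡1 zero    = trans (ℤₚ.*-identityʳ _) f0≡1
recip-inverse f f0≡1 (suc n) = trans
  (cong₂ ℤ._+_
    (trans (cong (λ z → z ℤ.* recip f (suc n)) f0≡1) (ℤₚ.*-identityˡ _))
    (sym (dot-recipCoeffs f (λ k → f (suc k)) n)))
  (ℤₚ.+-inverseˡ (dot (λ k → f (suc k)) (recipCoeffs f n)))

-- Σ∞ F is the sum of all F k, provided that F k is divisible by q ↑ k for
-- every k, so that only F 0, …, F n contribute to the coefficient of q ↑ n.
Σ∞ : (ℕ → Series) → Series
Σ∞ F n = Σ≤ n (λ k → F k n)

-- poch A Q n = (A;Q)_n
poch : Series → Series → ℕ → Series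
poch A Q zero    = one
poch A Q (suc n) = poch A Q n ⊛ (one ⊖ A ⊛ Q ↑ n)

-- poch∞ A Q = (A;Q)_∞, provided that Q has constant term 0: the factors
-- 1 - A Q^k with k > n are then congruent to 1 modulo q ↑ (n + 1), so the
-- coefficient of q ↑ n can be read off from (A;Q)_{n+1}.
poch∞ : Series → Series → Series
poch∞ A Q n = poch A Q (suc n) n

-- Here q ↑ (n * n) is divisible by q ↑ n, as Σ∞ requires.
G : Series
G = Σ∞ (λ n → q ↑ (n ℕ.* n) ⊛ recip (poch q q n))

H : Series
H = Σ∞ (λ n → q ↑ (n ℕ.* n ℕ.+ n) ⊛ recip (poch q q n))

-- A finite multiset of positive integers is represented by its weakly
-- decreasing list of elements.
IsPartition : List ℕ → Set
IsPartition xs = Linked _≥_ xs × All (0 <_) xs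

InClass : (a m : ℕ) .{{_ : NonZero m}} → ℕ → Set
InClass a m p = a ≤ p × p % m ≡ a % m

-- The arguments are m, γ, ρ, σ in this order; for γ empty, ρ is empty whatever
-- the number of parts of σ.
RhoCondition : ℕ → List ℕ → List ℕ → List ℕ → Set
RhoCondition m []        ρ σ = ρ ≡ []
RhoCondition m γ@(_ ∷ _) ρ σ = length ρ ≡ length σ × All (_≡ m ℕ.* length γ) ρ

Triple : Set
Triple = List ℕ × List ℕ × List ℕ

IsCopartition : (a b m : ℕ) .{{_ : NonZero m}} → Triple → Set
IsCopartition a b m (γ , ρ , σ) =
  (IsPartition γ × IsPartition ρ × IsPartition σ) ×
  All (InClass a m) γ × All (InClass b m) σ × RhoCondition m γ ρ σ

size : Triple → ℕ
size (γ , ρ , σ) = sum γ ℕ.+ sum ρ ℕ.+ sum σ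

IsCopartitionOf : (a b m : ℕ) .{{_ : NonZero m}} → ℕ → Triple → Set
IsCopartitionOf a b m n t = IsCopartition a b m t × size t ≡ n

CopartitionOf : (a b m : ℕ) .{{_ : NonZero m}} → ℕ → Set
CopartitionOf a b m n = Σ Triple (IsCopartitionOf a b m n)

isPartition? : ∀ xs → Dec (IsPartition xs)
isPartition? xs = linked? (λ x y → y ℕ.≤? x) xs ×-dec all? (0 ℕ.<?_) xs

inClass? : ∀ a m .{{_ : NonZero m}} p → Dec (InClass a m p)
inClass? a m p = (a ℕ.≤? p) ×-dec (p % m ℕ.≟ a % m)

rhoCondition? : ∀ m γ ρ σ → Dec (RhoCondition m γ ρ σ)
rhoCondition? m []        ρ σ = Listₚ.≡-dec ℕ._≟_ ρ []
rhoCondition? m γ@(_ ∷ _) ρ σ =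
  (length ρ ℕ.≟ length σ) ×-dec all? (ℕ._≟ (m ℕ.* length γ)) ρ

isCopartitionOf? : ∀ a b m .{{_ : NonZero m}} n t → Dec (IsCopartitionOf a b m n t)
isCopartitionOf? a b m n t@(γ , ρ , σ) =
  ((isPartition? γ ×-dec isPartition? ρ ×-dec isPartition? σ) ×-dec
   all? (inClass? a m) γ ×-dec all? (inClass? b m) σ ×-dec rhoCondition? m γ ρ σ)
  ×-dec (size t ℕ.≟ n)

-- All lists of length at most k with entries in {1, …, n}.
words : ℕ → ℕ → List (List ℕ)
words n zero    = [] ∷ []
words n (suc k) = [] ∷ cartesianProductWith _∷_ (applyUpTo suc n) (words n k)

-- All partitions of size at most n: they have at most n parts, none above n.
partitionsUpTo : ℕ → List (List ℕ)
partitionsUpTo n = filter (λ xs → isPartition? xs ×-dec (sum xs ℕ.≤? n)) (words n n)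

triplesUpTo : ℕ → List Triple
triplesUpTo n = cartesianProduct ps (cartesianProduct ps ps)
  where ps = partitionsUpTo n

copartitions : (a b m : ℕ) .{{_ : NonZero m}} → ℕ → List Triple
copartitions a b m n = filter (isCopartitionOf? a b m n) (triplesUpTo n)

cp : (a b m : ℕ) .{{_ : NonZero m}} → ℕ → ℕ
cp a b m n = length (copartitions a b m n)

-- The search is complete and free of repetitions: cp a b m n is the
-- cardinality of CopartitionOf a b m n (cp-correct below).

words-unique : ∀ n k → Unique (words n k)
words-unique n zero    = [] ∷ []
words-unique n (suc k) = fresh (applyUpTo suc n) ∷
  Uniqueₚ.cartesianProductWith⁺ _∷_ Listₚ.∷-injective
    (Uniqueₚ.applyUpTo⁺₁ suc n (λ i<j _ eq → ℕₚ.<⇒≢ i<j (ℕₚ.suc-injective eq)))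
    (words-unique n k)
  where
  fresh : ∀ xs → All ([] ≢_) (cartesianProductWith _∷_ xs (words n k))
  fresh []       = []
  fresh (x ∷ xs) = ++⁺ (map⁺ (All.universal (λ _ ()) (words n k))) (fresh xs)

words-complete : ∀ n k xs → All (0 <_) xs → sum xs ≤ n → sum xs ≤ k → xs ∈ words n k
words-complete n zero    []           _         _   _   = here refl
words-complete n (suc k) []           _         _   _   = here refl
words-complete n _       (zero ∷ xs)  (() ∷ _)
words-complete n zero    (suc x ∷ xs) _         _   ()
words-complete n (suc k) (suc x ∷ xs) (_ ∷ pos) ≤n (s≤s ≤k) = there
  (∈-cartesianProductWith⁺ _∷_
    (∈-applyUpTo⁺ suc (ℕₚ.≤-trans (ℕₚ.m≤m+n (suc x) (sum xs)) ≤n))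
    (words-complete n k xs pos
      (ℕₚ.≤-trans (ℕₚ.m≤n+m (sum xs) (suc x)) ≤n)
      (ℕₚ.≤-trans (ℕₚ.m≤n+m (sum xs) x) ≤k)))

partitionsUpTo-complete : ∀ n xs → IsPartition xs → sum xs ≤ n → xs ∈ partitionsUpTo n
partitionsUpTo-complete n xs p@(_ , pos) ≤n =
  ∈-filter⁺ _ (words-complete n n xs pos ≤n ≤n) (p , ≤n)

copartitions-unique : ∀ a b m .{{_ : NonZero m}} n → Unique (copartitions a b m n)
copartitions-unique a b m n =
  Uniqueₚ.filter⁺ _ (Uniqueₚ.cartesianProduct⁺ ps! (Uniqueₚ.cartesianProduct⁺ ps! ps!))
  where ps! = Uniqueₚ.filter⁺ (λ xs → isPartition? xs ×-dec (sum xs ℕ.≤? n)) (words-unique n n)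

copartitions-complete : ∀ a b m .{{_ : NonZero m}} n t →
                        IsCopartitionOf a b m n t → t ∈ copartitions a b m n
copartitions-complete a b m n (γ , ρ , σ) c@(((pγ , pρ , pσ) , _) , refl) =
  ∈-filter⁺ (isCopartitionOf? a b m n)
    (∈-cartesianProduct⁺
      (partitionsUpTo-complete n γ pγ (ℕₚ.≤-trans (ℕₚ.m≤m+n _ _) (ℕₚ.m≤m+n _ (sum σ))))
      (∈-cartesianProduct⁺
        (partitionsUpTo-complete n ρ pρ (ℕₚ.≤-trans (ℕₚ.m≤n+m _ (sum γ)) (ℕₚ.m≤m+n _ (sum σ))))
        (partitionsUpTo-complete n σ pσ (ℕₚ.m≤n+m _ _))))
    c

copartitions-sound : ∀ a b m .{{_ : NonZero m}} n {t} →
                     t ∈ copartitions a b m n → IsCopartitionOf a b m n t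
copartitions-sound a b m n t∈ =
  proj₂ (∈-filter⁻ (isCopartitionOf? a b m n) {xs = triplesUpTo n} t∈)

×-irrelevant : {A B : Set} → Irrelevant A → Irrelevant B → Irrelevant (A × B)
×-irrelevant irrA irrB (a , b) (a′ , b′) = cong₂ _,_ (irrA a a′) (irrB b b′)

isPartition-irrelevant : ∀ {xs} → Irrelevant (IsPartition xs)
isPartition-irrelevant =
  ×-irrelevant (Linked.irrelevant ℕₚ.≤-irrelevant) (All.irrelevant ℕₚ.≤-irrelevant)

rhoCondition-irrelevant : ∀ m γ {ρ σ} → Irrelevant (RhoCondition m γ ρ σ)
rhoCondition-irrelevant m []      = λ where refl refl → refl
rhoCondition-irrelevant m (_ ∷ _) =
  ×-irrelevant ℕₚ.≡-irrelevant (All.irrelevant ℕₚ.≡-irrelevant)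

isCopartitionOf-irrelevant : ∀ a b m .{{_ : NonZero m}} n t → Irrelevant (IsCopartitionOf a b m n t)
isCopartitionOf-irrelevant a b m n (γ , _) = ×-irrelevant
  (×-irrelevant
    (×-irrelevant isPartition-irrelevant (×-irrelevant isPartition-irrelevant isPartition-irrelevant))
    (×-irrelevant inClasses (×-irrelevant inClasses (rhoCondition-irrelevant m γ))))
  ℕₚ.≡-irrelevant
  where
  inClasses : ∀ {c xs} → Irrelevant (All (InClass c m) xs)
  inClasses = All.irrelevant (×-irrelevant ℕₚ.≤-irrelevant ℕₚ.≡-irrelevant)

cp-correct : ∀ a b m .{{_ : NonZero m}} n → Fin (cp a b m n) ↔ CopartitionOf a b m n
cp-correct a b m n = mk↔ₛ′ to from to∘from from∘to
  where
  L = copartitions a b m n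

  to : Fin (cp a b m n) → CopartitionOf a b m n
  to i = lookup L i , copartitions-sound a b m n (∈-lookup i)

  from : CopartitionOf a b m n → Fin (cp a b m n)
  from (t , c) = index (copartitions-complete a b m n t c)

  ext : ∀ {s t} (c : IsCopartitionOf a b m n s) (d : IsCopartitionOf a b m n t) →
        s ≡ t → _≡_ {A = CopartitionOf a b m n} (s , c) (t , d)
  ext {s} c d refl = cong (s ,_) (isCopartitionOf-irrelevant a b m n s c d)

  to∘from : ∀ x → to (from x) ≡ x
  to∘from (t , c) = ext _ c (sym (lookup-index (copartitions-complete a b m n t c)))

  from∘to : ∀ i → from (to i) ≡ i
  from∘to i = lookup-injective (copartitions-unique a b m n) _ i
    (sym (lookup-index (copartitions-complete a b m n (lookup L i) (proj₂ (to i)))))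
    where
    lookup-injective : ∀ {xs : List Triple} → Unique xs → ∀ i j → lookup xs i ≡ lookup xs j → i ≡ j
    lookup-injective (_ ∷ _)  Fin.zero    Fin.zero    _  = refl
    lookup-injective (x∉ ∷ _) Fin.zero    (Fin.suc j) eq with () ← All.lookup x∉ (∈-lookup j) eq
    lookup-injective (x∉ ∷ _) (Fin.suc i) Fin.zero    eq with () ← All.lookup x∉ (∈-lookup i) (sym eq)
    lookup-injective (_ ∷ u)  (Fin.suc i) (Fin.suc j) eq = cong Fin.suc (lookup-injective u i j eq)

cpSeries : (a b m : ℕ) .{{_ : NonZero m}} → Series
cpSeries a b m n = + cp a b m n

{-# OPTIONS --safe #-}
module Submission where

-- Write (x) for (x;Q)_∞ with Q = q^5.  Each identity says that a
-- Rogers-Ramanujan function F is a copartition series divided by (Q), and both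
-- sides are evaluated as infinite products.
--
-- Copartitions.  The partition ρ of a copartition (γ, ρ, σ) is determined by γ
-- and σ.  If γ has a part a, remove it, shorten every part of ρ by m, and add m
-- to every part of σ; otherwise all parts of γ are at least a + m.  This
-- bijection (pair-step), together with the symmetry between γ and σ, shows that
-- the generating function C(a,b) satisfies
--   C(a,b) = C(a+m,b) + q^a C(a,b+m) = C(a,b+m) + q^b C(a+m,b),
-- hence (1 - q^a) C(a,b) = (1 - q^(a+b)) C(a+m,b).  Since C(a,b) tends to 1 as
-- a and b grow, iteration in both arguments gives cpSeries-product:
--   (q^a;q^m)_∞ (q^b;q^m)_∞ C(a,b) = (q^(a+b);q^m)_∞.
--
-- Rogers-Ramanujan.  The series R(z) = Σ z^n q^(n²) / (q;q)_n satisfies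
-- R(z) = R(zq) + zq R(zq²), and so does Rogers's well-poised series J₂.  A family
-- indexed by z = q^i with this property is determined by its limit as i grows
-- (rogersFamily-unique), so (q;q)_∞ R(q^i) = J₂ i.  For i = 0 and i = 1 the
-- series J₂ collapses to a theta series Σ (-1)^n x^n Q^(n(n-1)/2) over all
-- integers n, with x = q^3 and x = q^4 respectively.
--
-- Jacobi.  With xy = Q, the sums Σ (-1)^r x^r Q^(r(r-1)/2) / (Q;Q)_(m+r) over
-- r ≥ -m are multiplied by 1 - yQ^m when m increases by one, and for m = 0 the
-- sum is Euler's expansion of (x).  Letting m grow gives triple-product: the
-- theta series equals (x)(y)(Q).
--
-- Since (q;q)_∞ = (q)(q^2)(q^3)(q^4)(Q), the last two parts give
-- (q)(q^4) G = 1 and (q^2)(q^3) H = 1, whereas C(1,4) = (Q) / ((q)(q^4)) and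
-- C(2,3) = (Q) / ((q^2)(q^3)) for m = 5.
--
-- Limits are handled by congruences modulo powers of q: two series are equal as
-- soon as they agree modulo every q^N, and modulo q^N all infinite sums and
-- products are finite.

open import Defs
open import Algebra.Bundles using (CommutativeRing)
import Algebra.Solver.Ring as RingSolver
open import Algebra.Solver.Ring.AlmostCommutativeRing
  using (fromCommutativeRing; _-Raw-AlmostCommutative⟶_)
open import Data.Empty using (⊥-elim)
open import Data.Fin using (Fin)
open import Data.Fin.Permutation using (↔⇒≡)
open import Data.Fin.Properties using (+↔⊎)
open import Data.Integer as ℤ using (ℤ; +_; -[1+_]; 0ℤ; 1ℤ)
import Data.Integer.Properties as ℤₚ
open import Data.Integer.Solver renaming (module +-*-Solver to ℤ-Solver)
open import Data.List using (List; []; _∷_; _∷ʳ_; length; map; replicate)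
import Data.List.Properties as Listₚ
open import Data.List.Relation.Unary.All as All using (All; []; _∷_)
import Data.List.Relation.Unary.All.Properties as Allₚ
open import Data.List.Relation.Unary.Linked as Linked using (Linked; []; [-]; _∷_)
import Data.List.Relation.Unary.Linked.Properties as Linkedₚ
open import Data.Maybe.Base using (Maybe; just; nothing)
open import Data.Nat as ℕ
  using (ℕ; zero; suc; _≤_; _<_; _≥_; z≤n; s≤s; _%_; _/_; NonZero; nonZero)
open import Data.Nat.DivMod using (m≡m%n+[m/n]*n; [m+n]%n≡m%n; m≤n⇒[n∸m]%m≡n%m)
open import Data.Nat.ListAction using (sum)
open import Data.Nat.ListAction.Properties using (sum-++)
import Data.Nat.Properties as ℕₚ
open import Data.Nat.Solver renaming (module +-*-Solver to ℕ-Solver)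
open import Data.Product using (Σ; ∃; _×_; _,_; proj₁; proj₂)
open import Data.Sum using (_⊎_; inj₁; inj₂)
open import Data.Sum.Function.Propositional using (_⊎-↔_)
open import Function.Base using (_∘_)
open import Function.Bundles using (_↔_; mk↔ₛ′)
open import Function.Properties.Inverse using (↔-sym; ↔-trans)
open import Level using (0ℓ)
open import Relation.Binary.Bundles using (Setoid)
open import Relation.Binary.PropositionalEquality
  using (_≡_; _≢_; _≗_; refl; sym; trans; cong; cong₂; subst; module ≡-Reasoning)
import Relation.Binary.Reasoning.Setoid as SetoidReasoning
open import Relation.Nullary using (¬_; Irrelevant; yes; no)

open ℕ-Solver using ()
  renaming (solve to solveℕ; _:+_ to _:+ℕ_; _:*_ to _:*ℕ_; _:=_ to _:=ℕ_; con to conℕ)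
open ℤ-Solver using ()
  renaming (solve to solveℤ; _:+_ to _:+ℤ_; _:*_ to _:*ℤ_; _:=_ to _:=ℤ_)

-- The ring of formal power series

infixl 6 _⊕_
infix  8 ⊝_

zeros : Series
zeros _ = 0ℤ

_⊕_ : Series → Series → Series
(f ⊕ g) n = f n ℤ.+ g n

⊝_ : Series → Series
(⊝ f) n = ℤ.- f n

scale : ℤ → Series → Series
scale c f n = c ℤ.* f n

-- The series (f - f 0) / q.
tail : Series → Series
tail f n = f (suc n)

-- f ≈[ N ] g means f ≡ g modulo q ↑ N.
infix 4 _≈[_]_
_≈[_]_ : Series → ℕ → Series → Set
f ≈[ N ] g = ∀ n → n < N → f n ≡ g n

-- Ord N f says that f is divisible by q ↑ N.
Ord : ℕ → Series → Set
Ord N f = f ≈[ N ] zeros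

≈-refl : ∀ {N f} → f ≈[ N ] f
≈-refl n _ = refl

≈-sym : ∀ {N f g} → f ≈[ N ] g → g ≈[ N ] f
≈-sym p n n<N = sym (p n n<N)

≈-trans : ∀ {N f g h} → f ≈[ N ] g → g ≈[ N ] h → f ≈[ N ] h
≈-trans p r n n<N = trans (p n n<N) (r n n<N)

≗⇒≈ : ∀ {N f g} → f ≗ g → f ≈[ N ] g
≗⇒≈ p n _ = p n

≈⇒≗ : ∀ {f g} → (∀ N → f ≈[ N ] g) → f ≗ g
≈⇒≗ p n = p (suc n) n ℕₚ.≤-refl

≈-weaken : ∀ {M N f g} → M ≤ N → f ≈[ N ] g → f ≈[ M ] g
≈-weaken M≤N p n n<M = p n (ℕₚ.≤-trans n<M M≤N)

≈-setoid : ℕ → Setoid 0ℓ 0ℓ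
≈-setoid N = record
  { Carrier = Series
  ; _≈_ = _≈[ N ]_
  ; isEquivalence = record { refl = ≈-refl ; sym = ≈-sym ; trans = ≈-trans }
  }

module ≈-Reasoning (N : ℕ) = SetoidReasoning (≈-setoid N)

⊕-mod : ∀ {N f f′ g g′} → f ≈[ N ] f′ → g ≈[ N ] g′ → f ⊕ g ≈[ N ] f′ ⊕ g′
⊕-mod p r n n<N = cong₂ ℤ._+_ (p n n<N) (r n n<N)

-- All laws of ⊛ follow by induction on the exponent from
-- tail (f ⊛ g) = f 0 * tail g + tail f ⊛ g, which holds by definition.

⊛-mod : ∀ {N f f′ g g′} → f ≈[ N ] f′ → g ≈[ N ] g′ → f ⊛ g ≈[ N ] f′ ⊛ g′
⊛-mod p r zero    n<N       = cong₂ ℤ._*_ (p 0 n<N) (r 0 n<N)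
⊛-mod p r (suc n) (s≤s n<N) = cong₂ ℤ._+_
  (cong₂ ℤ._*_ (p 0 (s≤s z≤n)) (r (suc n) (s≤s n<N)))
  (⊛-mod (λ k k< → p (suc k) (s≤s k<)) (≈-weaken (ℕₚ.n≤1+n _) r) n n<N)

⊛-cong : ∀ {f f′ g g′} → f ≗ f′ → g ≗ g′ → f ⊛ g ≗ f′ ⊛ g′
⊛-cong p r = ≈⇒≗ λ N → ⊛-mod (≗⇒≈ p) (≗⇒≈ r)

⊛-tailʳ : ∀ f g n → (f ⊛ g) (suc n) ≡ (f ⊛ tail g) n ℤ.+ f (suc n) ℤ.* g 0
⊛-tailʳ f g zero    = refl
⊛-tailʳ f g (suc n) = trans
  (cong (ℤ._+_ (f 0 ℤ.* g (suc (suc n)))) (⊛-tailʳ (tail f) g n))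
  (sym (ℤₚ.+-assoc (f 0 ℤ.* g (suc (suc n))) ((tail f ⊛ tail g) n) (f (suc (suc n)) ℤ.* g 0)))

⊛-comm : ∀ f g → f ⊛ g ≗ g ⊛ f
⊛-comm f g zero    = ℤₚ.*-comm (f 0) (g 0)
⊛-comm f g (suc n) = begin
  f 0 ℤ.* g (suc n) ℤ.+ (tail f ⊛ g) n  ≡⟨ cong₂ ℤ._+_ (ℤₚ.*-comm (f 0) (g (suc n))) (⊛-comm (tail f) g n) ⟩
  g (suc n) ℤ.* f 0 ℤ.+ (g ⊛ tail f) n  ≡⟨ ℤₚ.+-comm (g (suc n) ℤ.* f 0) ((g ⊛ tail f) n) ⟩
  (g ⊛ tail f) n ℤ.+ g (suc n) ℤ.* f 0  ≡⟨ ⊛-tailʳ g f n ⟨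
  (g ⊛ f) (suc n)                       ∎
  where open ≡-Reasoning

⊛-distribʳ : ∀ h f g → (f ⊕ g) ⊛ h ≗ f ⊛ h ⊕ g ⊛ h
⊛-distribʳ h f g zero    = ℤₚ.*-distribʳ-+ (h 0) (f 0) (g 0)
⊛-distribʳ h f g (suc n) = trans
  (cong (ℤ._+_ ((f 0 ℤ.+ g 0) ℤ.* h (suc n))) (⊛-distribʳ h (tail f) (tail g) n))
  (solveℤ 5 (λ a b c x y → (a :+ℤ b) :*ℤ c :+ℤ (x :+ℤ y) :=ℤ (a :*ℤ c :+ℤ x) :+ℤ (b :*ℤ c :+ℤ y)) refl
    (f 0) (g 0) (h (suc n)) ((tail f ⊛ h) n) ((tail g ⊛ h) n))

scale-⊛ : ∀ c f g → scale c f ⊛ g ≗ scale c (f ⊛ g)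
scale-⊛ c f g zero    = ℤₚ.*-assoc c (f 0) (g 0)
scale-⊛ c f g (suc n) = trans
  (cong (ℤ._+_ (c ℤ.* f 0 ℤ.* g (suc n))) (scale-⊛ c (tail f) g n))
  (solveℤ 4 (λ c a b x → c :*ℤ a :*ℤ b :+ℤ c :*ℤ x :=ℤ c :*ℤ (a :*ℤ b :+ℤ x)) refl
    c (f 0) (g (suc n)) ((tail f ⊛ g) n))

⊛-assoc : ∀ f g h → (f ⊛ g) ⊛ h ≗ f ⊛ (g ⊛ h)
⊛-assoc f g h zero    = ℤₚ.*-assoc (f 0) (g 0) (h 0)
⊛-assoc f g h (suc n) = begin
  f 0 ℤ.* g 0 ℤ.* h (suc n) ℤ.+ ((scale (f 0) (tail g) ⊕ tail f ⊛ g) ⊛ h) n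
    ≡⟨ cong (ℤ._+_ (f 0 ℤ.* g 0 ℤ.* h (suc n))) (⊛-distribʳ h (scale (f 0) (tail g)) (tail f ⊛ g) n) ⟩
  f 0 ℤ.* g 0 ℤ.* h (suc n) ℤ.+ ((scale (f 0) (tail g) ⊛ h) n ℤ.+ ((tail f ⊛ g) ⊛ h) n)
    ≡⟨ cong (λ z → f 0 ℤ.* g 0 ℤ.* h (suc n) ℤ.+ z)
         (cong₂ ℤ._+_ (scale-⊛ (f 0) (tail g) h n) (⊛-assoc (tail f) g h n)) ⟩
  f 0 ℤ.* g 0 ℤ.* h (suc n) ℤ.+ (f 0 ℤ.* (tail g ⊛ h) n ℤ.+ (tail f ⊛ (g ⊛ h)) n)
    ≡⟨ solveℤ 5 (λ a b c x y → a :*ℤ b :*ℤ c :+ℤ (a :*ℤ x :+ℤ y) :=ℤ a :*ℤ (b :*ℤ c :+ℤ x) :+ℤ y) refl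
         (f 0) (g 0) (h (suc n)) ((tail g ⊛ h) n) ((tail f ⊛ (g ⊛ h)) n) ⟩
  f 0 ℤ.* (g 0 ℤ.* h (suc n) ℤ.+ (tail g ⊛ h) n) ℤ.+ (tail f ⊛ (g ⊛ h)) n ∎
  where open ≡-Reasoning

⊛-zeroˡ : ∀ f → zeros ⊛ f ≗ zeros
⊛-zeroˡ f zero    = refl
⊛-zeroˡ f (suc n) = trans (ℤₚ.+-identityˡ _) (⊛-zeroˡ f n)

⊛-identityˡ : ∀ f → one ⊛ f ≗ f
⊛-identityˡ f zero    = ℤₚ.*-identityˡ (f 0)
⊛-identityˡ f (suc n) = trans
  (cong₂ ℤ._+_ (ℤₚ.*-identityˡ (f (suc n))) (⊛-zeroˡ f n)) (ℤₚ.+-identityʳ _)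

seriesRing : CommutativeRing 0ℓ 0ℓ
seriesRing = record
  { Carrier = Series ; _≈_ = _≗_ ; _+_ = _⊕_ ; _*_ = _⊛_ ; -_ = ⊝_ ; 0# = zeros ; 1# = one
  ; isCommutativeRing = record
    { isRing = record
      { +-isAbelianGroup = record
        { isGroup = record
          { isMonoid = record
            { isSemigroup = record
              { isMagma = record
                { isEquivalence = Setoid.isEquivalence ≗-setoid
                ; ∙-cong = λ p r n → cong₂ ℤ._+_ (p n) (r n) }
              ; assoc = λ f g h n → ℤₚ.+-assoc (f n) (g n) (h n) }
            ; identity = (λ f n → ℤₚ.+-identityˡ (f n)) , (λ f n → ℤₚ.+-identityʳ (f n)) }
          ; inverse = (λ f n → ℤₚ.+-inverseˡ (f n)) , (λ f n → ℤₚ.+-inverseʳ (f n))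
          ; ⁻¹-cong = λ p n → cong ℤ.-_ (p n) }
        ; comm = λ f g n → ℤₚ.+-comm (f n) (g n) }
      ; *-cong = ⊛-cong
      ; *-assoc = ⊛-assoc
      ; *-identity = ⊛-identityˡ , λ f n → trans (⊛-comm f one n) (⊛-identityˡ f n)
      ; distrib = (λ h f g n → trans (⊛-comm h (f ⊕ g) n) (trans (⊛-distribʳ h f g n)
                     (cong₂ ℤ._+_ (⊛-comm f h n) (⊛-comm g h n))))
                , ⊛-distribʳ }
    ; *-comm = ⊛-comm } }
  where
  ≗-setoid : Setoid 0ℓ 0ℓ
  ≗-setoid = record
    { Carrier = Series ; _≈_ = _≗_
    ; isEquivalence = record
      { refl = λ _ → refl ; sym = λ p n → sym (p n) ; trans = λ p r n → trans (p n) (r n) } }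

open CommutativeRing seriesRing using (setoid; +-cong; -‿cong)
  renaming (refl to ≗-refl; sym to ≗-sym; trans to ≗-trans)

module ≗-Reasoning = SetoidReasoning setoid

⊖-cong : ∀ {f f′ g g′} → f ≗ f′ → g ≗ g′ → f ⊖ g ≗ f′ ⊖ g′
⊖-cong p r n = cong₂ ℤ._-_ (p n) (r n)

⊛-congˡ : ∀ f {g g′} → g ≗ g′ → f ⊛ g ≗ f ⊛ g′
⊛-congˡ f = ⊛-cong {f} ≗-refl

⊛-congʳ : ∀ g {f f′} → f ≗ f′ → f ⊛ g ≗ f′ ⊛ g
⊛-congʳ g p = ⊛-cong {g = g} p ≗-refl

-- Constant series.  The separate clauses for 0 and 1 make the constants 0 and
-- 1 of the ring solver coincide with zeros and one by definition.
const : ℤ → Series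
const (+ 0) = zeros
const (+ 1) = one
const c     = λ { zero → c ; (suc _) → 0ℤ }

const-zero : ∀ c → const c 0 ≡ c
const-zero (+ 0)            = refl
const-zero (+ 1)            = refl
const-zero (+ suc (suc _))  = refl
const-zero -[1+ _ ]         = refl

const-suc : ∀ c n → const c (suc n) ≡ 0ℤ
const-suc (+ 0)           n = refl
const-suc (+ 1)           n = refl
const-suc (+ suc (suc _)) n = refl
const-suc -[1+ _ ]        n = refl

const-⊛ : ∀ c f → const c ⊛ f ≗ scale c f
const-⊛ c f zero    = cong (ℤ._* f 0) (const-zero c)
const-⊛ c f (suc n) = trans
  (cong₂ ℤ._+_ (cong (ℤ._* f (suc n)) (const-zero c))
    (trans (⊛-cong {g = f} (const-suc c) (λ _ → refl) n) (⊛-zeroˡ f n)))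
  (ℤₚ.+-identityʳ _)

-- Integer coefficients for the ring solver.
const-homo : ℤ.+-*-rawRing -Raw-AlmostCommutative⟶ fromCommutativeRing seriesRing
const-homo = record
  { ⟦_⟧    = const
  ; +-homo = λ where
      c d zero    → trans (const-zero (c ℤ.+ d)) (sym (cong₂ ℤ._+_ (const-zero c) (const-zero d)))
      c d (suc n) → trans (const-suc (c ℤ.+ d) n) (sym (cong₂ ℤ._+_ (const-suc c n) (const-suc d n)))
  ; *-homo = λ where
      c d zero    → trans (const-zero (c ℤ.* d))
        (sym (trans (const-⊛ c (const d) 0) (cong (c ℤ.*_) (const-zero d))))
      c d (suc n) → trans (const-suc (c ℤ.* d) n)
        (sym (trans (const-⊛ c (const d) (suc n))
          (trans (cong (c ℤ.*_) (const-suc d n)) (ℤₚ.*-zeroʳ c))))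
  ; -‿homo = λ where
      c zero    → trans (const-zero (ℤ.- c)) (sym (cong ℤ.-_ (const-zero c)))
      c (suc n) → trans (const-suc (ℤ.- c) n) (sym (cong ℤ.-_ (const-suc c n)))
  ; 0-homo = λ _ → refl
  ; 1-homo = λ _ → refl
  }

const-≟ : ∀ c d → Maybe (const c ≗ const d)
const-≟ c d with c ℤ.≟ d
... | yes refl = just ≗-refl
... | no  _    = nothing

module SeriesSolver =
  RingSolver ℤ.+-*-rawRing (fromCommutativeRing seriesRing) const-homo const-≟

open SeriesSolver using (solve; _:+_; _:*_; _:-_; :-_; _:^_; _:=_; con)

⊕-congˡ : ∀ f {g g′} → g ≗ g′ → f ⊕ g ≗ f ⊕ g′
⊕-congˡ f = +-cong (≗-refl {f})

⊕-congʳ : ∀ g {f f′} → f ≗ f′ → f ⊕ g ≗ f′ ⊕ g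
⊕-congʳ g p = +-cong p (≗-refl {g})

⊛-modˡ : ∀ {N} f {g g′} → g ≈[ N ] g′ → f ⊛ g ≈[ N ] f ⊛ g′
⊛-modˡ f = ⊛-mod (≈-refl {f = f})

⊛-modʳ : ∀ {N} g {f f′} → f ≈[ N ] f′ → f ⊛ g ≈[ N ] f′ ⊛ g
⊛-modʳ g p = ⊛-mod p (≈-refl {f = g})

-- Orders, powers and reciprocals

-- A factor divisible by q ↑ M improves the precision of the other one by M.
⊛-Ord : ∀ {M N f g h} → Ord M f → g ≈[ N ] h → f ⊛ g ≈[ M ℕ.+ N ] f ⊛ h
⊛-Ord {zero}  {f = f}         _  p                 = ⊛-modˡ f p
⊛-Ord {suc M} {f = f} {g} {h} of p zero    _ =
  trans (cong (ℤ._* g 0) (of 0 (s≤s z≤n))) (sym (cong (ℤ._* h 0) (of 0 (s≤s z≤n))))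
⊛-Ord {suc M} {N} {f} {g} {h} of p (suc n) (s≤s n<) = cong₂ ℤ._+_
  (trans (cong (ℤ._* g (suc n)) (of 0 (s≤s z≤n))) (sym (cong (ℤ._* h (suc n)) (of 0 (s≤s z≤n)))))
  (⊛-Ord {M} {N} {tail f} (λ k k< → of (suc k) (s≤s k<)) p n n<)

⊛-zeroʳ : ∀ f → f ⊛ zeros ≗ zeros
⊛-zeroʳ f = ≗-trans (⊛-comm f zeros) (⊛-zeroˡ f)

Ord-⊛ : ∀ {M N f g} → Ord M f → Ord N g → Ord (M ℕ.+ N) (f ⊛ g)
Ord-⊛ {f = f} of og = ≈-trans (⊛-Ord of og) (≗⇒≈ (⊛-zeroʳ f))

Ord-⊛ˡ : ∀ {N f} g → Ord N f → Ord N (f ⊛ g)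
Ord-⊛ˡ g of = ≈-trans (⊛-modʳ g of) (≗⇒≈ (⊛-zeroˡ g))

Ord-⊛ʳ : ∀ {N} f {g} → Ord N g → Ord N (f ⊛ g)
Ord-⊛ʳ f og = ≈-trans (⊛-modˡ f og) (≗⇒≈ (⊛-zeroʳ f))

Ord-⊝ : ∀ {N f} → Ord N f → Ord N (⊝ f)
Ord-⊝ of n n< = cong ℤ.-_ (of n n<)

Ord-0 : ∀ {f} → Ord 0 f
Ord-0 _ ()

Ord-↑ : ∀ {f} → Ord 1 f → ∀ k → Ord k (f ↑ k)
Ord-↑ of zero    = Ord-0
Ord-↑ of (suc k) = Ord-⊛ of (Ord-↑ of k)

Ord-q : Ord 1 q
Ord-q zero    _         = refl
Ord-q (suc _) (s≤s ())

Ord-q↑ : ∀ k → Ord k (q ↑ k)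
Ord-q↑ = Ord-↑ Ord-q

↑-+ : ∀ f m n → f ↑ (m ℕ.+ n) ≗ f ↑ m ⊛ f ↑ n
↑-+ f zero    n = ≗-sym (⊛-identityˡ (f ↑ n))
↑-+ f (suc m) n = ≗-trans (⊛-congˡ f (↑-+ f m n)) (≗-sym (⊛-assoc f (f ↑ m) (f ↑ n)))

q↑-shift : ∀ d f n → (q ↑ d ⊛ f) (d ℕ.+ n) ≡ f n
q↑-shift zero    f n = ⊛-identityˡ f n
q↑-shift (suc d) f n = begin
  (q ⊛ q ↑ d ⊛ f) (suc d ℕ.+ n)           ≡⟨ ⊛-assoc q (q ↑ d) f (suc d ℕ.+ n) ⟩
  (q ⊛ (q ↑ d ⊛ f)) (suc d ℕ.+ n)         ≡⟨ ℤₚ.+-identityˡ _ ⟩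
  (tail q ⊛ (q ↑ d ⊛ f)) (d ℕ.+ n)        ≡⟨ ⊛-congʳ (q ↑ d ⊛ f) {tail q} {one} (λ where zero → refl ; (suc _) → refl) (d ℕ.+ n) ⟩
  (one ⊛ (q ↑ d ⊛ f)) (d ℕ.+ n)           ≡⟨ ⊛-identityˡ (q ↑ d ⊛ f) (d ℕ.+ n) ⟩
  (q ↑ d ⊛ f) (d ℕ.+ n)                   ≡⟨ q↑-shift d f n ⟩
  f n                                     ∎
  where open ≡-Reasoning

1-f≈1 : ∀ {N f} → Ord N f → one ⊖ f ≈[ N ] one
1-f≈1 of n n< = trans (cong (ℤ._-_ (one n)) (of n n<)) (ℤₚ.+-identityʳ (one n))

↑-* : ∀ f m n → f ↑ (n ℕ.* m) ≗ (f ↑ m) ↑ n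
↑-* f m zero    = ≗-refl
↑-* f m (suc n) = ≗-trans (↑-+ f m (n ℕ.* m)) (⊛-congˡ (f ↑ m) (↑-* f m n))

↑-⊛ : ∀ f g n → (f ⊛ g) ↑ n ≗ f ↑ n ⊛ g ↑ n
↑-⊛ f g zero    = ≗-sym (⊛-identityˡ one)
↑-⊛ f g (suc n) = ≗-trans (⊛-congˡ (f ⊛ g) (↑-⊛ f g n))
  (solve 4 (λ a b x y → a :* b :* (x :* y) := a :* x :* (b :* y)) ≗-refl f g (f ↑ n) (g ↑ n))

one-↑ : ∀ n → one ↑ n ≗ one
one-↑ zero    = ≗-refl
one-↑ (suc n) = ≗-trans (⊛-identityˡ (one ↑ n)) (one-↑ n)

↑-comm : ∀ f m n → (f ↑ m) ↑ n ≗ (f ↑ n) ↑ m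
↑-comm f zero    n = one-↑ n
↑-comm f (suc m) n = ≗-trans (↑-⊛ f (f ↑ m) n) (⊛-congˡ (f ↑ n) (↑-comm f m n))

recip-cancel : ∀ f g → f 0 ≡ 1ℤ → recip f ⊛ (f ⊛ g) ≗ g
recip-cancel f g f0 = begin
  recip f ⊛ (f ⊛ g)  ≈⟨ solve 3 (λ r f g → r :* (f :* g) := f :* r :* g) ≗-refl (recip f) f g ⟩
  f ⊛ recip f ⊛ g    ≈⟨ ⊛-congʳ g (recip-inverse f f0) ⟩
  one ⊛ g            ≈⟨ ⊛-identityˡ g ⟩
  g                  ∎
  where open ≗-Reasoning

⊛-cancelˡ : ∀ f {g h} → f 0 ≡ 1ℤ → f ⊛ g ≗ f ⊛ h → g ≗ h
⊛-cancelˡ f {g} {h} f0 p = begin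
  g                   ≈⟨ recip-cancel f g f0 ⟨
  recip f ⊛ (f ⊛ g)   ≈⟨ ⊛-congˡ (recip f) p ⟩
  recip f ⊛ (f ⊛ h)   ≈⟨ recip-cancel f h f0 ⟩
  h                   ∎
  where open ≗-Reasoning

-- Finite and infinite sums

-- psum F L = F 0 + … + F (L - 1)
psum : (ℕ → Series) → ℕ → Series
psum F zero    = zeros
psum F (suc L) = F 0 ⊕ psum (F ∘ suc) L

psum-vanish : ∀ F L n → (∀ k → F k n ≡ 0ℤ) → psum F L n ≡ 0ℤ
psum-vanish F zero    n p = refl
psum-vanish F (suc L) n p = cong₂ ℤ._+_ (p 0) (psum-vanish (F ∘ suc) L n (p ∘ suc))

psum-extend : ∀ F L j n → (∀ k → L ≤ k → F k n ≡ 0ℤ) → psum F (L ℕ.+ j) n ≡ psum F L n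
psum-extend F zero    j n p = psum-vanish F j n (λ k → p k z≤n)
psum-extend F (suc L) j n p =
  cong (ℤ._+_ (F 0 n)) (psum-extend (F ∘ suc) L j n (λ k L≤k → p (suc k) (s≤s L≤k)))

psum-⊛ : ∀ c F L → c ⊛ psum F L ≗ psum (λ k → c ⊛ F k) L
psum-⊛ c F zero    = ⊛-zeroʳ c
psum-⊛ c F (suc L) = ≗-trans
  (solve 3 (λ c x y → c :* (x :+ y) := c :* x :+ c :* y) ≗-refl c (F 0) (psum (F ∘ suc) L))
  (⊕-congˡ (c ⊛ F 0) (psum-⊛ c (F ∘ suc) L))

psum≡Σ≤ : ∀ F L n → psum F (suc L) n ≡ Σ≤ L (λ k → F k n)
psum≡Σ≤ F zero    n = ℤₚ.+-identityʳ (F 0 n)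
psum≡Σ≤ F (suc L) n = cong (ℤ._+_ (F 0 n)) (psum≡Σ≤ (F ∘ suc) L n)

-- The condition under which Σ∞ F is the sum of all F k.
Summable : (ℕ → Series) → Set
Summable F = ∀ k → Ord k (F k)

Summable-suc : ∀ {F} → Summable F → Summable (F ∘ suc)
Summable-suc s k = ≈-weaken (ℕₚ.n≤1+n k) (s (suc k))

Σ∞≈psum : ∀ {F} → Summable F → ∀ N → Σ∞ F ≈[ N ] psum F N
Σ∞≈psum {F} s N n n<N = begin
  Σ∞ F n                                ≡⟨ psum≡Σ≤ F n n ⟨
  psum F (suc n) n                      ≡⟨ psum-extend F (suc n) (N ℕ.∸ suc n) n (λ k n<k → s k n n<k) ⟨
  psum F (suc n ℕ.+ (N ℕ.∸ suc n)) n    ≡⟨ cong (λ L → psum F L n) (ℕₚ.m+[n∸m]≡n n<N) ⟩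
  psum F N n                            ∎
  where open ≡-Reasoning

Σ∞-mod : ∀ {N F F′} → (∀ k → F k ≈[ N ] F′ k) → Σ∞ F ≈[ N ] Σ∞ F′
Σ∞-mod {F = F} {F′} p n n<N = go n (λ k → p k n n<N)
  where
  go : ∀ m {s t : ℕ → ℤ} → (∀ k → s k ≡ t k) → Σ≤ m s ≡ Σ≤ m t
  go zero    e = e 0
  go (suc m) e = cong₂ ℤ._+_ (e 0) (go m (e ∘ suc))

Σ∞-cong : ∀ {F F′} → (∀ k → F k ≗ F′ k) → Σ∞ F ≗ Σ∞ F′
Σ∞-cong p = ≈⇒≗ λ N → Σ∞-mod λ k → ≗⇒≈ (p k)

Σ∞-⊕ : ∀ F F′ → Σ∞ F ⊕ Σ∞ F′ ≗ Σ∞ (λ k → F k ⊕ F′ k)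
Σ∞-⊕ F F′ n = go n (λ k → F k n) (λ k → F′ k n)
  where
  go : ∀ m (s t : ℕ → ℤ) → Σ≤ m s ℤ.+ Σ≤ m t ≡ Σ≤ m (λ k → s k ℤ.+ t k)
  go zero    s t = refl
  go (suc m) s t = trans
    (solveℤ 4 (λ a b c d → (a :+ℤ b) :+ℤ (c :+ℤ d) :=ℤ (a :+ℤ c) :+ℤ (b :+ℤ d)) refl
      (s 0) (Σ≤ m (s ∘ suc)) (t 0) (Σ≤ m (t ∘ suc)))
    (cong (ℤ._+_ (s 0 ℤ.+ t 0)) (go m (s ∘ suc) (t ∘ suc)))

Σ∞-⊛ : ∀ c {F} → Summable F → c ⊛ Σ∞ F ≗ Σ∞ (λ k → c ⊛ F k)
Σ∞-⊛ c {F} s = ≈⇒≗ λ N → let open ≈-Reasoning N in begin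
  c ⊛ Σ∞ F                 ≈⟨ ⊛-modˡ c (Σ∞≈psum s N) ⟩
  c ⊛ psum F N             ≈⟨ ≗⇒≈ (psum-⊛ c F N) ⟩
  psum (λ k → c ⊛ F k) N   ≈⟨ Σ∞≈psum (λ k → Ord-⊛ʳ c (s k)) N ⟨
  Σ∞ (λ k → c ⊛ F k)       ∎

Σ∞-suc : ∀ {F} → Summable F → Σ∞ F ≗ F 0 ⊕ Σ∞ (F ∘ suc)
Σ∞-suc {F} s = ≈⇒≗ λ N → let open ≈-Reasoning N in begin
  Σ∞ F                       ≈⟨ ≈-weaken (ℕₚ.n≤1+n N) (Σ∞≈psum s (suc N)) ⟩
  F 0 ⊕ psum (F ∘ suc) N     ≈⟨ ⊕-mod (≈-refl {f = F 0}) (Σ∞≈psum (Summable-suc s) N) ⟨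
  F 0 ⊕ Σ∞ (F ∘ suc)         ∎

-- An infinite sum may be rearranged by moving part of each term to its
-- predecessor, if the first term loses nothing.
Σ∞-telescope : ∀ X Y → Summable X → X 0 ≗ zeros →
               Σ∞ (λ n → X n ⊕ Y n) ≗ Σ∞ (λ n → X (suc n) ⊕ Y n)
Σ∞-telescope X Y s X0 = begin
  Σ∞ (λ n → X n ⊕ Y n)             ≈⟨ Σ∞-⊕ X Y ⟨
  Σ∞ X ⊕ Σ∞ Y                      ≈⟨ ⊕-congʳ (Σ∞ Y) (Σ∞-suc s) ⟩
  X 0 ⊕ Σ∞ (X ∘ suc) ⊕ Σ∞ Y        ≈⟨ ⊕-congʳ (Σ∞ Y) (⊕-congʳ (Σ∞ (X ∘ suc)) X0) ⟩
  zeros ⊕ Σ∞ (X ∘ suc) ⊕ Σ∞ Y      ≈⟨ ⊕-congʳ (Σ∞ Y) (λ n → ℤₚ.+-identityˡ (Σ∞ (X ∘ suc) n)) ⟩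
  Σ∞ (X ∘ suc) ⊕ Σ∞ Y              ≈⟨ Σ∞-⊕ (X ∘ suc) Y ⟩
  Σ∞ (λ n → X (suc n) ⊕ Y n)       ∎
  where open ≗-Reasoning

Σ∞≈head : ∀ {N F} → Summable F → (∀ k → Ord N (F (suc k))) → Σ∞ F ≈[ N ] F 0
Σ∞≈head {N} {F} s o = begin
  Σ∞ F                       ≈⟨ ≗⇒≈ (Σ∞-suc s) ⟩
  F 0 ⊕ Σ∞ (F ∘ suc)         ≈⟨ ⊕-mod (≈-refl {f = F 0}) (Σ∞-mod o) ⟩
  F 0 ⊕ Σ∞ (λ _ → zeros)     ≈⟨ ≗⇒≈ (λ n → trans (cong (ℤ._+_ (F 0 n)) (zero-sum n)) (ℤₚ.+-identityʳ _)) ⟩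
  F 0                        ∎
  where
  open ≈-Reasoning N
  zero-sum : ∀ n → Σ≤ n (λ _ → 0ℤ) ≡ 0ℤ
  zero-sum zero    = refl
  zero-sum (suc n) = trans (ℤₚ.+-identityˡ _) (zero-sum n)

-- q-shifted factorials

poch-0 : ∀ A Q → A 0 ≡ 0ℤ → ∀ n → poch A Q n 0 ≡ 1ℤ
poch-0 A Q A0 zero    = refl
poch-0 A Q A0 (suc n) = begin
  poch A Q n 0 ℤ.* (1ℤ ℤ.- A 0 ℤ.* (Q ↑ n) 0)  ≡⟨ cong₂ (λ x y → x ℤ.* (1ℤ ℤ.- y ℤ.* (Q ↑ n) 0)) (poch-0 A Q A0 n) A0 ⟩
  1ℤ                                            ∎
  where open ≡-Reasoning

poch-step : ∀ A {Q} → Ord 1 Q → ∀ n → poch A Q (suc n) ≈[ n ] poch A Q n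
poch-step A {Q} oQ n = ≈-trans
  (⊛-modˡ (poch A Q n) (1-f≈1 (Ord-⊛ʳ A (Ord-↑ oQ n))))
  (≗⇒≈ (≗-trans (⊛-comm (poch A Q n) one) (⊛-identityˡ (poch A Q n))))

poch-stable : ∀ A {Q} → Ord 1 Q → ∀ N j → poch A Q (N ℕ.+ j) ≈[ N ] poch A Q N
poch-stable A {Q} oQ N zero    rewrite ℕₚ.+-identityʳ N = ≈-refl
poch-stable A {Q} oQ N (suc j) rewrite ℕₚ.+-suc N j = ≈-trans
  (≈-weaken (ℕₚ.m≤m+n N j) (poch-step A oQ (N ℕ.+ j))) (poch-stable A oQ N j)

poch∞≈poch : ∀ A {Q} → Ord 1 Q → ∀ {N L} → N ≤ L → poch∞ A Q ≈[ N ] poch A Q L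
poch∞≈poch A {Q} oQ {N} {L} N≤L n n<N = begin
  poch A Q (suc n) n                      ≡⟨ poch-stable A oQ (suc n) (L ℕ.∸ suc n) n ℕₚ.≤-refl ⟨
  poch A Q (suc n ℕ.+ (L ℕ.∸ suc n)) n    ≡⟨ cong (λ m → poch A Q m n) (ℕₚ.m+[n∸m]≡n (ℕₚ.≤-trans n<N N≤L)) ⟩
  poch A Q L n                            ∎
  where open ≡-Reasoning

poch-cong : ∀ {A A′} Q → A ≗ A′ → ∀ n → poch A Q n ≗ poch A′ Q n
poch-cong Q p zero    = ≗-refl
poch-cong Q p (suc n) = ⊛-cong (poch-cong Q p n) (⊖-cong (≗-refl {one}) (⊛-congʳ (Q ↑ n) p))

poch-limit : ∀ {N A} Q → Ord N A → ∀ n → poch A Q n ≈[ N ] one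
poch-limit Q oA zero    = ≈-refl
poch-limit Q oA (suc n) = ≈-trans
  (⊛-mod (poch-limit Q oA n) (1-f≈1 (Ord-⊛ˡ (Q ↑ n) oA)))
  (≗⇒≈ (⊛-identityˡ one))

-- The reciprocal of (Q;Q)_n
rpoch : Series → ℕ → Series
rpoch Q n = recip (poch Q Q n)

rpoch-inverse : ∀ {Q} → Ord 1 Q → ∀ n → poch Q Q n ⊛ rpoch Q n ≗ one
rpoch-inverse {Q} oQ n = recip-inverse (poch Q Q n) (poch-0 Q Q (oQ 0 (s≤s z≤n)) n)

rpoch-0 : ∀ {Q} → Ord 1 Q → rpoch Q 0 ≗ one
rpoch-0 {Q} oQ = ≗-trans (≗-sym (⊛-identityˡ (rpoch Q 0))) (rpoch-inverse oQ 0)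

rpoch-suc : ∀ {Q} → Ord 1 Q → ∀ n → (one ⊖ Q ⊛ Q ↑ n) ⊛ rpoch Q (suc n) ≗ rpoch Q n
rpoch-suc {Q} oQ n = ⊛-cancelˡ (poch Q Q n) (poch-0 Q Q (oQ 0 (s≤s z≤n)) n) (begin
  poch Q Q n ⊛ ((one ⊖ Q ⊛ Q ↑ n) ⊛ rpoch Q (suc n))  ≈⟨ ⊛-assoc (poch Q Q n) (one ⊖ Q ⊛ Q ↑ n) (rpoch Q (suc n)) ⟨
  poch Q Q (suc n) ⊛ rpoch Q (suc n)                  ≈⟨ rpoch-inverse oQ (suc n) ⟩
  one                                                 ≈⟨ rpoch-inverse oQ n ⟨
  poch Q Q n ⊛ rpoch Q n                              ∎)
  where open ≗-Reasoning

-- Theta series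

-- theta x Q n = (-1)^n x^n Q^(n(n-1)/2)
theta : Series → Series → ℕ → Series
theta x Q zero    = one
theta x Q (suc n) = ⊝ (theta x Q n ⊛ (x ⊛ Q ↑ n))

theta-summable : ∀ {x Q} → Ord 1 x → Summable (theta x Q)
theta-summable ox zero = Ord-0
theta-summable {x} {Q} ox (suc n) = ≈-weaken (ℕₚ.≤-reflexive (ℕₚ.+-comm 1 n))
  (Ord-⊝ (Ord-⊛ (theta-summable ox n) (Ord-⊛ˡ (Q ↑ n) ox)))

theta-cong : ∀ {x x′} Q → x ≗ x′ → ∀ n → theta x Q n ≗ theta x′ Q n
theta-cong Q p zero    = ≗-refl
theta-cong Q p (suc n) = -‿cong (⊛-cong (theta-cong Q p n) (⊛-congʳ (Q ↑ n) p))

theta-scale : ∀ x z Q n → theta (x ⊛ z) Q n ≗ theta x Q n ⊛ z ↑ n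
theta-scale x z Q zero    = ≗-sym (⊛-identityˡ one)
theta-scale x z Q (suc n) = ≗-trans
  (-‿cong (⊛-congʳ (x ⊛ z ⊛ Q ↑ n) (theta-scale x z Q n)))
  (solve 5 (λ t zn x z Qn → :- (t :* zn :* (x :* z :* Qn)) := :- (t :* (x :* Qn)) :* (z :* zn)) ≗-refl
    (theta x Q n) (z ↑ n) x z (Q ↑ n))

-- If xz = yQ, then the (n + 1)-st term in y is a multiple of the n-th term in x.
theta-pair : ∀ x y z Q → x ⊛ z ≗ y ⊛ Q → ∀ n →
             theta y Q (suc n) ≗ ⊝ (theta x Q n ⊛ (y ⊛ z ↑ n))
theta-pair x y z Q p zero    = ≗-refl
theta-pair x y z Q p (suc n) = begin
  ⊝ (theta y Q (suc n) ⊛ (y ⊛ (Q ⊛ Q ↑ n)))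
    ≈⟨ -‿cong (⊛-congʳ (y ⊛ (Q ⊛ Q ↑ n)) (theta-pair x y z Q p n)) ⟩
  ⊝ (⊝ (theta x Q n ⊛ (y ⊛ z ↑ n)) ⊛ (y ⊛ (Q ⊛ Q ↑ n)))
    ≈⟨ solve 5 (λ t y zn Q Qn → :- (:- (t :* (y :* zn)) :* (y :* (Q :* Qn)))
                             := t :* y :* zn :* Qn :* (y :* Q)) ≗-refl
         (theta x Q n) y (z ↑ n) Q (Q ↑ n) ⟩
  theta x Q n ⊛ y ⊛ z ↑ n ⊛ Q ↑ n ⊛ (y ⊛ Q)
    ≈⟨ ⊛-congˡ (theta x Q n ⊛ y ⊛ z ↑ n ⊛ Q ↑ n) p ⟨
  theta x Q n ⊛ y ⊛ z ↑ n ⊛ Q ↑ n ⊛ (x ⊛ z)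
    ≈⟨ solve 6 (λ t y zn Qn x z → t :* y :* zn :* Qn :* (x :* z)
                               := :- (:- (t :* (x :* Qn)) :* (y :* (z :* zn)))) ≗-refl
         (theta x Q n) y (z ↑ n) (Q ↑ n) x z ⟩
  ⊝ (theta x Q (suc n) ⊛ (y ⊛ (z ⊛ z ↑ n))) ∎
  where open ≗-Reasoning

-- Θ x y Q = Σ over all integers n of (-1)^n x^n Q^(n(n-1)/2), provided xy = Q;
-- the term of index -n is theta y Q n.
Θ : Series → Series → Series → Series
Θ x y Q = Σ∞ (λ n → theta x Q n ⊕ theta y Q (suc n))

-- Rogers's q-difference equation

-- R(z) = Σ z^n q^(n²) / (q;q)_n at z = q^i; thus R(1) = G and R(q) = H.
rogers : ℕ → Series
rogers i = Σ∞ (λ n → q ↑ (n ℕ.* n ℕ.+ i ℕ.* n) ⊛ rpoch q n)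

n≤n*n : ∀ n → n ≤ n ℕ.* n
n≤n*n zero    = z≤n
n≤n*n (suc n) = ℕₚ.m≤m*n (suc n) (suc n)

rogers-summable : ∀ i → Summable (λ n → q ↑ (n ℕ.* n ℕ.+ i ℕ.* n) ⊛ rpoch q n)
rogers-summable i n = Ord-⊛ˡ (rpoch q n)
  (≈-weaken (ℕₚ.≤-trans (n≤n*n n) (ℕₚ.m≤m+n (n ℕ.* n) (i ℕ.* n))) (Ord-q↑ (n ℕ.* n ℕ.+ i ℕ.* n)))

-- The family X satisfies X(z) = X(zq) + zq X(zq²) at all z = q^i.
IsRogersFamily : (ℕ → Series) → Set
IsRogersFamily X = ∀ i → X i ≗ X (suc i) ⊕ q ↑ suc i ⊛ X (suc (suc i))

-- Write 1 = (1 - q^n) + q^n in the n-th term: the first part cancels the last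
-- factor of (q;q)_n and becomes, shifted by one, a term of zq R(zq²).
rogers-isRogersFamily : IsRogersFamily rogers
rogers-isRogersFamily i = begin
  rogers i
    ≈⟨ Σ∞-cong (λ n → split n) ⟩
  Σ∞ (λ n → X n ⊕ Y n)
    ≈⟨ Σ∞-telescope X Y X-summable X0 ⟩
  Σ∞ (λ n → X (suc n) ⊕ Y n)
    ≈⟨ Σ∞-cong (λ n → ≗-trans (⊕-congʳ (Y n) (X-suc n)) (λ k → ℤₚ.+-comm _ (Y n k))) ⟩
  Σ∞ (λ n → Y n ⊕ q ↑ suc i ⊛ (q ↑ (n ℕ.* n ℕ.+ suc (suc i) ℕ.* n) ⊛ r n))
    ≈⟨ Σ∞-⊕ Y (λ n → q ↑ suc i ⊛ (q ↑ (n ℕ.* n ℕ.+ suc (suc i) ℕ.* n) ⊛ r n)) ⟨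
  rogers (suc i) ⊕ Σ∞ (λ n → q ↑ suc i ⊛ (q ↑ (n ℕ.* n ℕ.+ suc (suc i) ℕ.* n) ⊛ r n))
    ≈⟨ ⊕-congˡ (rogers (suc i)) (Σ∞-⊛ (q ↑ suc i) (rogers-summable (suc (suc i)))) ⟨
  rogers (suc i) ⊕ q ↑ suc i ⊛ rogers (suc (suc i)) ∎
  where
  open ≗-Reasoning
  r = rpoch q
  e : ℕ → ℕ
  e n = n ℕ.* n ℕ.+ i ℕ.* n
  X Y : ℕ → Series
  X n = q ↑ e n ⊛ (one ⊖ q ↑ n) ⊛ r n
  Y n = q ↑ (n ℕ.* n ℕ.+ suc i ℕ.* n) ⊛ r n

  split : ∀ n → q ↑ e n ⊛ r n ≗ X n ⊕ Y n
  split n = begin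
    q ↑ e n ⊛ r n
      ≈⟨ solve 3 (λ a b c → a :* c := a :* (con 1ℤ :- b) :* c :+ a :* b :* c) ≗-refl (q ↑ e n) (q ↑ n) (r n) ⟩
    X n ⊕ q ↑ e n ⊛ q ↑ n ⊛ r n
      ≈⟨ ⊕-congˡ (X n) (⊛-congʳ (r n) (↑-+ q (e n) n)) ⟨
    X n ⊕ q ↑ (e n ℕ.+ n) ⊛ r n
      ≡⟨ cong (λ k → X n ⊕ q ↑ k ⊛ r n)
           (solveℕ 2 (λ n i → n :*ℕ n :+ℕ i :*ℕ n :+ℕ n :=ℕ n :*ℕ n :+ℕ (conℕ 1 :+ℕ i) :*ℕ n) refl n i) ⟩
    X n ⊕ Y n ∎

  X-summable : Summable X
  X-summable n = Ord-⊛ˡ (r n) (Ord-⊛ˡ (one ⊖ q ↑ n)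
    (≈-weaken (ℕₚ.≤-trans (n≤n*n n) (ℕₚ.m≤m+n (n ℕ.* n) (i ℕ.* n))) (Ord-q↑ (e n))))

  X0 : X 0 ≗ zeros
  X0 = solve 2 (λ a b → a :* (con 1ℤ :- con 1ℤ) :* b := con 0ℤ) ≗-refl (q ↑ e 0) (r 0)

  X-suc : ∀ n → X (suc n) ≗ q ↑ suc i ⊛ (q ↑ (n ℕ.* n ℕ.+ suc (suc i) ℕ.* n) ⊛ r n)
  X-suc n = begin
    q ↑ e (suc n) ⊛ (one ⊖ q ↑ suc n) ⊛ r (suc n)
      ≈⟨ ⊛-assoc (q ↑ e (suc n)) (one ⊖ q ↑ suc n) (r (suc n)) ⟩
    q ↑ e (suc n) ⊛ ((one ⊖ q ↑ suc n) ⊛ r (suc n))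
      ≈⟨ ⊛-congˡ (q ↑ e (suc n)) (rpoch-suc Ord-q n) ⟩
    q ↑ e (suc n) ⊛ r n
      ≡⟨ cong (λ k → q ↑ k ⊛ r n)
           (solveℕ 2 (λ n i → (conℕ 1 :+ℕ n) :*ℕ (conℕ 1 :+ℕ n) :+ℕ i :*ℕ (conℕ 1 :+ℕ n)
              :=ℕ (conℕ 1 :+ℕ i) :+ℕ (n :*ℕ n :+ℕ (conℕ 2 :+ℕ i) :*ℕ n)) refl n i) ⟩
    q ↑ (suc i ℕ.+ (n ℕ.* n ℕ.+ suc (suc i) ℕ.* n)) ⊛ r n
      ≈⟨ ⊛-congʳ (r n) (↑-+ q (suc i) (n ℕ.* n ℕ.+ suc (suc i) ℕ.* n)) ⟩
    q ↑ suc i ⊛ q ↑ (n ℕ.* n ℕ.+ suc (suc i) ℕ.* n) ⊛ r n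
      ≈⟨ ⊛-assoc (q ↑ suc i) (q ↑ (n ℕ.* n ℕ.+ suc (suc i) ℕ.* n)) (r n) ⟩
    q ↑ suc i ⊛ (q ↑ (n ℕ.* n ℕ.+ suc (suc i) ℕ.* n) ⊛ r n) ∎

rogers-limit : ∀ i → rogers i ≈[ i ] one
rogers-limit i = ≈-trans
  (Σ∞≈head (rogers-summable i) (λ k → Ord-⊛ˡ (rpoch q (suc k))
    (≈-weaken (ℕₚ.≤-trans (ℕₚ.m≤m*n i (suc k)) (ℕₚ.m≤n+m (i ℕ.* suc k) (suc k ℕ.* suc k)))
      (Ord-q↑ (suc k ℕ.* suc k ℕ.+ i ℕ.* suc k)))))
  (≗⇒≈ head)
  where
  head : q ↑ (i ℕ.* 0) ⊛ rpoch q 0 ≗ one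
  head rewrite ℕₚ.*-zeroʳ i = ≗-trans (⊛-identityˡ (rpoch q 0)) (rpoch-0 Ord-q)

-- A family with the q-difference equation is determined by its limit: because of
-- the factor q ↑ suc i, agreement of all members modulo q ↑ N implies that X i and
-- Y i agree modulo q ↑ (N + 1) if X (i + 1) and Y (i + 1) do.
rogersFamily-unique : ∀ {X Y} → IsRogersFamily X → IsRogersFamily Y →
                      (∀ i → X i ≈[ i ] Y i) → ∀ i → X i ≗ Y i
rogersFamily-unique {X} {Y} RX RY lim i = ≈⇒≗ (λ N → agree N i)
  where
  agree : ∀ N i → X i ≈[ N ] Y i
  agree zero    i = λ _ ()
  agree (suc N) i = down (suc N) i (ℕₚ.m≤n+m (suc N) i)
    where
    down : ∀ d i → suc N ≤ i ℕ.+ d → X i ≈[ suc N ] Y i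
    down zero    i le = ≈-weaken (ℕₚ.≤-trans le (ℕₚ.≤-reflexive (ℕₚ.+-identityʳ i))) (lim i)
    down (suc d) i le = begin
      X i                                          ≈⟨ ≗⇒≈ (RX i) ⟩
      X (suc i) ⊕ q ↑ suc i ⊛ X (suc (suc i))
        ≈⟨ ⊕-mod (down d (suc i) (ℕₚ.≤-trans le (ℕₚ.≤-reflexive (ℕₚ.+-suc i d))))
             (≈-weaken (s≤s (ℕₚ.m≤n+m N i)) (⊛-Ord (Ord-q↑ (suc i)) (agree N (suc (suc i))))) ⟩
      Y (suc i) ⊕ q ↑ suc i ⊛ Y (suc (suc i))      ≈⟨ ≗⇒≈ (RY i) ⟨
      Y i                                          ∎
      where open ≈-Reasoning (suc N)

-- The well-poised solution

-- (q;q)_{i+n} / (q;q)_n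
ratio : ℕ → ℕ → Series
ratio i n = poch q q (i ℕ.+ n) ⊛ rpoch q n

ratio-left : ∀ i n → (one ⊖ q ⊛ q ↑ n) ⊛ ratio i (suc n) ≗ ratio (suc i) n
ratio-left i n rewrite ℕₚ.+-suc i n = ≗-trans
  (solve 3 (λ a p r → a :* (p :* r) := p :* (a :* r)) ≗-refl
    (one ⊖ q ⊛ q ↑ n) (poch q q (suc (i ℕ.+ n))) (rpoch q (suc n)))
  (⊛-congˡ (poch q q (suc (i ℕ.+ n))) (rpoch-suc Ord-q n))

ratio-right : ∀ i n → (one ⊖ q ⊛ (q ↑ i ⊛ q ↑ n)) ⊛ ratio i n ≗ ratio (suc i) n
ratio-right i n = ≗-trans
  (⊛-congʳ (ratio i n) (⊖-cong (≗-refl {one}) (⊛-congˡ q (≗-sym (↑-+ q i n)))))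
  (solve 3 (λ a p r → a :* (p :* r) := p :* a :* r) ≗-refl
    (one ⊖ q ⊛ q ↑ (i ℕ.+ n)) (poch q q (i ℕ.+ n)) (rpoch q n))

-- With thetaArg i = q^(3 + 2i), the series τ i n below is
-- (-1)^n z^(2n) q^(n(5n+1)/2 - 2n) for z = q^(i+1).
thetaArg : ℕ → Series
thetaArg i = q ↑ 3 ⊛ (q ↑ i ⊛ q ↑ i)

τ : ℕ → ℕ → Series
τ i = theta (thetaArg i) (q ↑ 5)

τ-suc : ∀ i n → τ i (suc n) ≗ ⊝ (τ i n ⊛ (thetaArg i ⊛ (q ↑ n) ↑ 5))
τ-suc i n = -‿cong (⊛-congˡ (τ i n) (⊛-congˡ (thetaArg i) (↑-comm q 5 n)))

τ-shift : ∀ i n → τ (suc i) n ≗ τ i n ⊛ (q ↑ n ⊛ q ↑ n)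
τ-shift i n = begin
  τ (suc i) n                     ≈⟨ theta-cong (q ↑ 5) (solve 2 (λ q I → q :^ 3 :* (q :* I :* (q :* I))
                                       := q :^ 3 :* (I :* I) :* (q :* q)) ≗-refl q (q ↑ i)) n ⟩
  theta (thetaArg i ⊛ (q ⊛ q)) (q ↑ 5) n  ≈⟨ theta-scale (thetaArg i) (q ⊛ q) (q ↑ 5) n ⟩
  τ i n ⊛ (q ⊛ q) ↑ n             ≈⟨ ⊛-congˡ (τ i n) (↑-⊛ q q n) ⟩
  τ i n ⊛ (q ↑ n ⊛ q ↑ n)         ∎
  where open ≗-Reasoning

thetaArg-Ord : ∀ i → Ord 1 (thetaArg i)
thetaArg-Ord i = Ord-⊛ˡ (q ↑ i ⊛ q ↑ i) (≈-weaken (s≤s z≤n) (Ord-q↑ 3))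

-- For k = 1, 2 and z = q^(i+1), the series J₁ i and J₂ i are (q;q)_∞ times Rogers's series
--   Σ (-1)^n z^(2n) q^(n(5n+1)/2 - kn) (1 - z^k q^(2kn)) / ((q;q)_n (zq^n;q)_∞),
-- where (q;q)_∞ / (zq^n;q)_∞ = (q;q)_(i+n).
J₁-term J₂-term : ℕ → ℕ → Series
J₁-term i n = τ i n ⊛ (q ↑ n ⊛ (one ⊖ q ⊛ (q ↑ i ⊛ (q ↑ n) ↑ 2))) ⊛ ratio i n
J₂-term i n = τ i n ⊛ (one ⊖ q ↑ 2 ⊛ ((q ↑ i) ↑ 2 ⊛ (q ↑ n) ↑ 4)) ⊛ ratio i n

J₁ J₂ : ℕ → Series
J₁ i = Σ∞ (J₁-term i)
J₂ i = Σ∞ (J₂-term i)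

τ-summable : ∀ i (F : ℕ → Series) → Summable (λ n → τ i n ⊛ F n ⊛ ratio i n)
τ-summable i F n = Ord-⊛ˡ (ratio i n) (Ord-⊛ˡ (F n) (theta-summable (thetaArg-Ord i) n))

-- Split q^n (1 - zq^(2n)) = q^n (1 - q^n) + q^(2n) (1 - zq^n): the factor 1 - q^n
-- cancels against 1 / (q;q)_n, and 1 - zq^n extends (q;q)_(i+n).
J₁≗J₂ : ∀ i → J₁ i ≗ J₂ (suc i)
J₁≗J₂ i = begin
  J₁ i                          ≈⟨ Σ∞-cong split ⟩
  Σ∞ (λ n → X n ⊕ Y n)          ≈⟨ Σ∞-telescope X Y (τ-summable i (λ n → q ↑ n ⊛ (one ⊖ q ↑ n))) X0 ⟩
  Σ∞ (λ n → X (suc n) ⊕ Y n)    ≈⟨ Σ∞-cong join ⟩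
  J₂ (suc i)                    ∎
  where
  open ≗-Reasoning
  X Y : ℕ → Series
  X n = τ i n ⊛ (q ↑ n ⊛ (one ⊖ q ↑ n)) ⊛ ratio i n
  Y n = τ i n ⊛ (q ↑ n ⊛ q ↑ n ⊛ (one ⊖ q ⊛ (q ↑ i ⊛ q ↑ n))) ⊛ ratio i n

  split : ∀ n → J₁-term i n ≗ X n ⊕ Y n
  split n = solve 5 (λ q I N t w →
      t :* (N :* (con 1ℤ :- q :* (I :* N :^ 2))) :* w
      := t :* (N :* (con 1ℤ :- N)) :* w :+ t :* (N :* N :* (con 1ℤ :- q :* (I :* N))) :* w)
    ≗-refl q (q ↑ i) (q ↑ n) (τ i n) (ratio i n)

  X0 : X 0 ≗ zeros
  X0 = solve 2 (λ t w → t :* (con 1ℤ :* (con 1ℤ :- con 1ℤ)) :* w := con 0ℤ) ≗-refl (τ i 0) (ratio i 0)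

  join : ∀ n → X (suc n) ⊕ Y n ≗ J₂-term (suc i) n
  join n = begin
    X (suc n) ⊕ Y n
      ≈⟨ solve 7 (λ t N a v t′ b w → t :* (N :* a) :* v :+ t′ :* (b) :* w
                  := t :* N :* (a :* v) :+ t′ :* b :* w) ≗-refl
           (τ i (suc n)) (q ↑ suc n) (one ⊖ q ↑ suc n) (ratio i (suc n))
           (τ i n) (q ↑ n ⊛ q ↑ n ⊛ (one ⊖ q ⊛ (q ↑ i ⊛ q ↑ n))) (ratio i n) ⟩
    τ i (suc n) ⊛ q ↑ suc n ⊛ ((one ⊖ q ↑ suc n) ⊛ ratio i (suc n)) ⊕ Y n
      ≈⟨ +-cong
           (⊛-cong (⊛-congʳ (q ↑ suc n) (τ-suc i n)) (ratio-left i n))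
           (≗-trans
             (solve 4 (λ t b c w → t :* (b :* c) :* w := t :* b :* (c :* w)) ≗-refl
               (τ i n) (q ↑ n ⊛ q ↑ n) (one ⊖ q ⊛ (q ↑ i ⊛ q ↑ n)) (ratio i n))
             (⊛-congˡ (τ i n ⊛ (q ↑ n ⊛ q ↑ n)) (ratio-right i n))) ⟩
    ⊝ (τ i n ⊛ (thetaArg i ⊛ (q ↑ n) ↑ 5)) ⊛ q ↑ suc n ⊛ ratio (suc i) n
      ⊕ τ i n ⊛ (q ↑ n ⊛ q ↑ n) ⊛ ratio (suc i) n
      ≈⟨ solve 5 (λ q I N t w →
             :- (t :* (q :^ 3 :* (I :* I) :* N :^ 5)) :* (q :* N) :* w :+ t :* (N :* N) :* w
             := t :* (N :* N) :* (con 1ℤ :- q :^ 2 :* ((q :* I) :^ 2 :* N :^ 4)) :* w)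
           ≗-refl q (q ↑ i) (q ↑ n) (τ i n) (ratio (suc i) n) ⟩
    τ i n ⊛ (q ↑ n ⊛ q ↑ n) ⊛ (one ⊖ q ↑ 2 ⊛ ((q ↑ suc i) ↑ 2 ⊛ (q ↑ n) ↑ 4)) ⊛ ratio (suc i) n
      ≈⟨ ⊛-congʳ (ratio (suc i) n)
           (⊛-congʳ (one ⊖ q ↑ 2 ⊛ ((q ↑ suc i) ↑ 2 ⊛ (q ↑ n) ↑ 4)) (τ-shift i n)) ⟨
    J₂-term (suc i) n ∎

-- The difference of the terms of J₂ and J₁ splits in the same way:
-- 1 - z²q^(4n) - q^n (1 - zq^(2n)) = (1 - q^n) + zq^(3n) (1 - zq^n).
J₂-isRogersFamily : IsRogersFamily J₂
J₂-isRogersFamily i = begin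
  J₂ i
    ≈⟨ Σ∞-cong split ⟩
  Σ∞ (λ n → J₁-term i n ⊕ (X n ⊕ Y n))
    ≈⟨ Σ∞-⊕ (J₁-term i) (λ n → X n ⊕ Y n) ⟨
  J₁ i ⊕ Σ∞ (λ n → X n ⊕ Y n)
    ≈⟨ ⊕-congˡ (J₁ i) (Σ∞-telescope X Y (τ-summable i (λ n → one ⊖ q ↑ n)) X0) ⟩
  J₁ i ⊕ Σ∞ (λ n → X (suc n) ⊕ Y n)
    ≈⟨ ⊕-congˡ (J₁ i) (Σ∞-cong join) ⟩
  J₁ i ⊕ Σ∞ (λ n → q ↑ suc i ⊛ J₁-term (suc i) n)
    ≈⟨ ⊕-congˡ (J₁ i) (Σ∞-⊛ (q ↑ suc i) (τ-summable (suc i)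
         (λ n → q ↑ n ⊛ (one ⊖ q ⊛ (q ↑ suc i ⊛ (q ↑ n) ↑ 2))))) ⟨
  J₁ i ⊕ q ↑ suc i ⊛ J₁ (suc i)
    ≈⟨ +-cong (J₁≗J₂ i) (⊛-congˡ (q ↑ suc i) (J₁≗J₂ (suc i))) ⟩
  J₂ (suc i) ⊕ q ↑ suc i ⊛ J₂ (suc (suc i)) ∎
  where
  open ≗-Reasoning
  X Y : ℕ → Series
  X n = τ i n ⊛ (one ⊖ q ↑ n) ⊛ ratio i n
  Y n = τ i n ⊛ (q ↑ suc i ⊛ (q ↑ n) ↑ 3 ⊛ (one ⊖ q ⊛ (q ↑ i ⊛ q ↑ n))) ⊛ ratio i n

  split : ∀ n → J₂-term i n ≗ J₁-term i n ⊕ (X n ⊕ Y n)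
  split n = solve 5 (λ q I N t w →
      t :* (con 1ℤ :- q :^ 2 :* (I :^ 2 :* N :^ 4)) :* w
      := t :* (N :* (con 1ℤ :- q :* (I :* N :^ 2))) :* w
         :+ (t :* (con 1ℤ :- N) :* w
             :+ t :* (q :* I :* N :^ 3 :* (con 1ℤ :- q :* (I :* N))) :* w))
    ≗-refl q (q ↑ i) (q ↑ n) (τ i n) (ratio i n)

  X0 : X 0 ≗ zeros
  X0 = solve 2 (λ t w → t :* (con 1ℤ :- con 1ℤ) :* w := con 0ℤ) ≗-refl (τ i 0) (ratio i 0)

  join : ∀ n → X (suc n) ⊕ Y n ≗ q ↑ suc i ⊛ J₁-term (suc i) n
  join n = begin
    X (suc n) ⊕ Y n
      ≈⟨ +-cong
           (≗-trans (⊛-assoc (τ i (suc n)) (one ⊖ q ↑ suc n) (ratio i (suc n)))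
             (⊛-cong (τ-suc i n) (ratio-left i n)))
           (≗-trans
             (solve 4 (λ t b c w → t :* (b :* c) :* w := t :* b :* (c :* w)) ≗-refl
               (τ i n) (q ↑ suc i ⊛ (q ↑ n) ↑ 3) (one ⊖ q ⊛ (q ↑ i ⊛ q ↑ n)) (ratio i n))
             (⊛-congˡ (τ i n ⊛ (q ↑ suc i ⊛ (q ↑ n) ↑ 3)) (ratio-right i n))) ⟩
    ⊝ (τ i n ⊛ (thetaArg i ⊛ (q ↑ n) ↑ 5)) ⊛ ratio (suc i) n
      ⊕ τ i n ⊛ (q ↑ suc i ⊛ (q ↑ n) ↑ 3) ⊛ ratio (suc i) n
      ≈⟨ solve 5 (λ q I N t w →
             :- (t :* (q :^ 3 :* (I :* I) :* N :^ 5)) :* w :+ t :* (q :* I :* N :^ 3) :* w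
             := q :* I :* (t :* (N :* N) :* (N :* (con 1ℤ :- q :* (q :* I :* N :^ 2))) :* w))
           ≗-refl q (q ↑ i) (q ↑ n) (τ i n) (ratio (suc i) n) ⟩
    q ↑ suc i ⊛ (τ i n ⊛ (q ↑ n ⊛ q ↑ n) ⊛ c ⊛ ratio (suc i) n)
      ≈⟨ ⊛-congˡ (q ↑ suc i) (⊛-congʳ (ratio (suc i) n) (⊛-congʳ c (τ-shift i n))) ⟨
    q ↑ suc i ⊛ J₁-term (suc i) n ∎
    where c = q ↑ n ⊛ (one ⊖ q ⊛ (q ↑ suc i ⊛ (q ↑ n) ↑ 2))

J₂-limit : ∀ i → J₂ i ≈[ i ] poch∞ q q
J₂-limit i = begin
  J₂ i                             ≈⟨ Σ∞≈head (τ-summable i F) (λ k → Ord-⊛ˡ (ratio i (suc k))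
                                        (Ord-⊛ˡ (F (suc k)) (Ord-⊝ (Ord-⊛ʳ (τ i k)
                                          (Ord-⊛ˡ ((q ↑ 5) ↑ k) (Ord-⊛ʳ (q ↑ 3) (Ord-⊛ˡ (q ↑ i) (Ord-q↑ i)))))))) ⟩
  one ⊛ F 0 ⊛ ratio i 0            ≈⟨ ⊛-modʳ (ratio i 0) (⊛-modˡ one
                                        (1-f≈1 (Ord-⊛ʳ (q ↑ 2) (Ord-⊛ˡ ((q ↑ 0) ↑ 4) (Ord-⊛ˡ ((q ↑ i) ↑ 1) (Ord-q↑ i)))))) ⟩
  one ⊛ one ⊛ ratio i 0            ≈⟨ ≗⇒≈ (⊛-congˡ (one ⊛ one)
                                        (⊛-congˡ (poch q q (i ℕ.+ 0)) (rpoch-0 Ord-q))) ⟩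
  one ⊛ one ⊛ (poch q q (i ℕ.+ 0) ⊛ one)  ≈⟨ ≗⇒≈ (solve 1 (λ p → con 1ℤ :* con 1ℤ :* (p :* con 1ℤ) := p) ≗-refl
                                               (poch q q (i ℕ.+ 0))) ⟩
  poch q q (i ℕ.+ 0)               ≈⟨ poch∞≈poch q Ord-q (ℕₚ.m≤m+n i 0) ⟨
  poch∞ q q                        ∎
  where
  open ≈-Reasoning i
  F : ℕ → Series
  F n = one ⊖ q ↑ 2 ⊛ ((q ↑ i) ↑ 2 ⊛ (q ↑ n) ↑ 4)

rogers-J₂ : ∀ i → poch∞ q q ⊛ rogers i ≗ J₂ i
rogers-J₂ = rogersFamily-unique scaled J₂-isRogersFamily limits
  where
  scaled : IsRogersFamily (λ i → poch∞ q q ⊛ rogers i)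
  scaled i = ≗-trans (⊛-congˡ (poch∞ q q) (rogers-isRogersFamily i))
    (solve 4 (λ p a b c → p :* (a :+ b :* c) := p :* a :+ b :* (p :* c)) ≗-refl
      (poch∞ q q) (rogers (suc i)) (q ↑ suc i) (rogers (suc (suc i))))
  limits : ∀ i → poch∞ q q ⊛ rogers i ≈[ i ] J₂ i
  limits i = begin
    poch∞ q q ⊛ rogers i  ≈⟨ ⊛-modˡ (poch∞ q q) (rogers-limit i) ⟩
    poch∞ q q ⊛ one       ≈⟨ ≗⇒≈ (≗-trans (⊛-comm (poch∞ q q) one) (⊛-identityˡ (poch∞ q q))) ⟩
    poch∞ q q             ≈⟨ J₂-limit i ⟨
    J₂ i                  ∎
    where open ≈-Reasoning i

ratio-0 : ∀ n → ratio 0 n ≗ one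
ratio-0 = rpoch-inverse Ord-q

thetaArg-0 : thetaArg 0 ≗ q ↑ 3
thetaArg-0 = solve 1 (λ x → x :* (con 1ℤ :* con 1ℤ) := x) ≗-refl (q ↑ 3)

-- At i = 0 the factor (q;q)_(i+n) / (q;q)_n is 1; the second half of each term of
-- J₂ 0 is the term of negative index of the theta series.
rogers-0-Θ : poch∞ q q ⊛ rogers 0 ≗ Θ (q ↑ 3) (q ↑ 2) (q ↑ 5)
rogers-0-Θ = ≗-trans (rogers-J₂ 0) (Σ∞-cong λ n → begin
  τ 0 n ⊛ (one ⊖ q ↑ 2 ⊛ (one ↑ 2 ⊛ (q ↑ n) ↑ 4)) ⊛ ratio 0 n
    ≈⟨ ⊛-congˡ (τ 0 n ⊛ (one ⊖ q ↑ 2 ⊛ (one ↑ 2 ⊛ (q ↑ n) ↑ 4))) (ratio-0 n) ⟩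
  τ 0 n ⊛ (one ⊖ q ↑ 2 ⊛ (one ↑ 2 ⊛ (q ↑ n) ↑ 4)) ⊛ one
    ≈⟨ ⊛-congʳ one (⊛-congʳ (one ⊖ q ↑ 2 ⊛ (one ↑ 2 ⊛ (q ↑ n) ↑ 4)) (theta-cong (q ↑ 5) thetaArg-0 n)) ⟩
  t n ⊛ (one ⊖ q ↑ 2 ⊛ (one ↑ 2 ⊛ (q ↑ n) ↑ 4)) ⊛ one
    ≈⟨ solve 3 (λ t y N → t :* (con 1ℤ :- y :* (con 1ℤ :^ 2 :* N)) :* con 1ℤ := t :+ :- (t :* (y :* N))) ≗-refl
         (t n) (q ↑ 2) ((q ↑ n) ↑ 4) ⟩
  t n ⊕ ⊝ (t n ⊛ (q ↑ 2 ⊛ (q ↑ n) ↑ 4))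
    ≈⟨ ⊕-congˡ (t n) (≗-trans
         (theta-pair (q ↑ 3) (q ↑ 2) (q ↑ 4) (q ↑ 5)
           (solve 1 (λ q → q :^ 3 :* q :^ 4 := q :^ 2 :* q :^ 5) ≗-refl q) n)
         (-‿cong (⊛-congˡ (t n) (⊛-congˡ (q ↑ 2) (↑-comm q 4 n))))) ⟨
  t n ⊕ theta (q ↑ 2) (q ↑ 5) (suc n) ∎)
  where
  open ≗-Reasoning
  t = theta (q ↑ 3) (q ↑ 5)

-- By J₁≗J₂ the case i = 1 of J₂ is the case i = 0 of J₁.
rogers-1-Θ : poch∞ q q ⊛ rogers 1 ≗ Θ (q ↑ 4) (q ↑ 1) (q ↑ 5)
rogers-1-Θ = ≗-trans (rogers-J₂ 1) (≗-trans (≗-sym (J₁≗J₂ 0)) (Σ∞-cong λ n → begin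
  τ 0 n ⊛ (q ↑ n ⊛ c n) ⊛ ratio 0 n
    ≈⟨ ⊛-cong (⊛-congʳ (q ↑ n ⊛ c n) (theta-cong (q ↑ 5) thetaArg-0 n)) (ratio-0 n) ⟩
  theta (q ↑ 3) (q ↑ 5) n ⊛ (q ↑ n ⊛ c n) ⊛ one
    ≈⟨ solve 4 (λ t N q M → t :* (N :* (con 1ℤ :- q :* (con 1ℤ :* M))) :* con 1ℤ
                            := t :* N :+ :- (t :* N :* (q :^ 1 :* M))) ≗-refl
         (theta (q ↑ 3) (q ↑ 5) n) (q ↑ n) q ((q ↑ n) ↑ 2) ⟩
  theta (q ↑ 3) (q ↑ 5) n ⊛ q ↑ n ⊕ ⊝ (theta (q ↑ 3) (q ↑ 5) n ⊛ q ↑ n ⊛ (q ↑ 1 ⊛ (q ↑ n) ↑ 2))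
    ≈⟨ +-cong (rescale n) (-‿cong (⊛-congʳ (q ↑ 1 ⊛ (q ↑ n) ↑ 2) (rescale n))) ⟨
  t n ⊕ ⊝ (t n ⊛ (q ↑ 1 ⊛ (q ↑ n) ↑ 2))
    ≈⟨ ⊕-congˡ (t n) (≗-trans
         (theta-pair (q ↑ 4) (q ↑ 1) (q ↑ 2) (q ↑ 5)
           (solve 1 (λ q → q :^ 4 :* q :^ 2 := q :^ 1 :* q :^ 5) ≗-refl q) n)
         (-‿cong (⊛-congˡ (t n) (⊛-congˡ (q ↑ 1) (↑-comm q 2 n))))) ⟨
  t n ⊕ theta (q ↑ 1) (q ↑ 5) (suc n) ∎))
  where
  open ≗-Reasoning
  t = theta (q ↑ 4) (q ↑ 5)
  c : ℕ → Series
  c n = one ⊖ q ⊛ (one ⊛ (q ↑ n) ↑ 2)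
  rescale : ∀ n → t n ≗ theta (q ↑ 3) (q ↑ 5) n ⊛ q ↑ n
  rescale n = ≗-trans
    (theta-cong (q ↑ 5) (solve 1 (λ q → q :^ 4 := q :^ 3 :* q) ≗-refl q) n)
    (theta-scale (q ↑ 3) q (q ↑ 5) n)

-- Euler's product and the Jacobi triple product

-- conv F G m = F 0 ⊛ G m ⊕ … ⊕ F m ⊛ G 0
conv : (F G : ℕ → Series) → ℕ → Series
conv F G zero    = F 0 ⊛ G 0
conv F G (suc m) = F 0 ⊛ G (suc m) ⊕ conv (F ∘ suc) G m

conv-cong : ∀ {F F′} G → (∀ s → F s ≗ F′ s) → ∀ m → conv F G m ≗ conv F′ G m
conv-cong G p zero    = ⊛-congʳ (G 0) (p 0)
conv-cong G p (suc m) = +-cong (⊛-congʳ (G (suc m)) (p 0)) (conv-cong G (p ∘ suc) m)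

conv-scale : ∀ c F G m → conv (λ s → c ⊛ F s) G m ≗ c ⊛ conv F G m
conv-scale c F G zero    = ⊛-assoc c (F 0) (G 0)
conv-scale c F G (suc m) = ≗-trans
  (⊕-congˡ (c ⊛ F 0 ⊛ G (suc m)) (conv-scale c (F ∘ suc) G m))
  (solve 4 (λ c f g x → c :* f :* g :+ c :* x := c :* (f :* g :+ x)) ≗-refl
    c (F 0) (G (suc m)) (conv (F ∘ suc) G m))

conv-scaleʳ : ∀ c F G m → conv F (λ s → c ⊛ G s) m ≗ c ⊛ conv F G m
conv-scaleʳ c F G zero    = solve 3 (λ c f g → f :* (c :* g) := c :* (f :* g)) ≗-refl c (F 0) (G 0)
conv-scaleʳ c F G (suc m) = ≗-trans
  (⊕-congˡ (F 0 ⊛ (c ⊛ G (suc m))) (conv-scaleʳ c (F ∘ suc) G m))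
  (solve 4 (λ c f g x → f :* (c :* g) :+ c :* x := c :* (f :* g :+ x)) ≗-refl
    c (F 0) (G (suc m)) (conv (F ∘ suc) G m))

-- If G tends to 1, then conv F G tends to the sum of F.  The offset d is needed for
-- the induction, which drops the first terms of F.
conv-limit : ∀ d {F G} → (∀ s → Ord (d ℕ.+ s) (F s)) → (∀ k → G k ≈[ k ] one) →
             ∀ m → conv F G m ≈[ d ℕ.+ m ] psum F (suc m)
conv-limit d {F} {G} oF lG zero    = ≈-trans (Ord-⊛ˡ (G 0) (oF 0)) (≈-sym (≈-trans (≗⇒≈ (λ n → ℤₚ.+-identityʳ (F 0 n))) (oF 0)))
conv-limit d {F} {G} oF lG (suc m) = ⊕-mod
  (≈-trans
    (⊛-Ord (≈-weaken (ℕₚ.m≤m+n d 0) (oF 0)) (lG (suc m)))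
    (≗⇒≈ (≗-trans (⊛-comm (F 0) one) (⊛-identityˡ (F 0)))))
  (≈-weaken (ℕₚ.≤-reflexive (ℕₚ.+-suc d m))
    (conv-limit (suc d) (λ s → ≈-weaken (ℕₚ.≤-reflexive (sym (ℕₚ.+-suc d s))) (oF (suc s))) lG m))

module _ {Q : Series} (Ord-Q : Ord 1 Q) where

  private
    ρ = rpoch Q

  -- Σ (-1)^n z^n Q^(n(n-1)/2) / (Q;Q)_n, which Euler evaluated as (z;Q)_∞.
  euler : Series → Series
  euler z = Σ∞ (λ n → theta z Q n ⊛ ρ n)

  euler-summable : ∀ {z} → Ord 1 z → Summable (λ n → theta z Q n ⊛ ρ n)
  euler-summable oz n = Ord-⊛ˡ (ρ n) (theta-summable oz n)

  euler-cong : ∀ {z z′} → z ≗ z′ → euler z ≗ euler z′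
  euler-cong p = Σ∞-cong λ n → ⊛-congʳ (ρ n) (theta-cong Q p n)

  -- Split 1 = (1 - Q^n) + Q^n in the n-th term.
  euler-step : ∀ {z} → Ord 1 z → euler z ≗ (one ⊖ z) ⊛ euler (z ⊛ Q)
  euler-step {z} oz = begin
    euler z
      ≈⟨ Σ∞-cong (λ n → solve 3 (λ t N r → t :* r := t :* ((con 1ℤ :- N) :* r) :+ t :* N :* r) ≗-refl
           (theta z Q n) (Q ↑ n) (ρ n)) ⟩
    Σ∞ (λ n → X n ⊕ Y n)
      ≈⟨ Σ∞-telescope X Y (λ n → Ord-⊛ˡ ((one ⊖ Q ↑ n) ⊛ ρ n) (theta-summable oz n))
           (solve 2 (λ t r → t :* ((con 1ℤ :- con 1ℤ) :* r) := con 0ℤ) ≗-refl one (ρ 0)) ⟩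
    Σ∞ (λ n → X (suc n) ⊕ Y n)
      ≈⟨ Σ∞-cong join ⟩
    Σ∞ (λ n → (one ⊖ z) ⊛ (theta (z ⊛ Q) Q n ⊛ ρ n))
      ≈⟨ Σ∞-⊛ (one ⊖ z) (euler-summable (Ord-⊛ˡ Q oz)) ⟨
    (one ⊖ z) ⊛ euler (z ⊛ Q) ∎
    where
    open ≗-Reasoning
    X Y : ℕ → Series
    X n = theta z Q n ⊛ ((one ⊖ Q ↑ n) ⊛ ρ n)
    Y n = theta z Q n ⊛ Q ↑ n ⊛ ρ n
    join : ∀ n → X (suc n) ⊕ Y n ≗ (one ⊖ z) ⊛ (theta (z ⊛ Q) Q n ⊛ ρ n)
    join n = begin
      X (suc n) ⊕ Y n
        ≈⟨ ⊕-congʳ (Y n) (⊛-congˡ (theta z Q (suc n)) (rpoch-suc Ord-Q n)) ⟩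
      theta z Q (suc n) ⊛ ρ n ⊕ Y n
        ≈⟨ solve 4 (λ t z N r → :- (t :* (z :* N)) :* r :+ t :* N :* r := (con 1ℤ :- z) :* (t :* N :* r)) ≗-refl
             (theta z Q n) z (Q ↑ n) (ρ n) ⟩
      (one ⊖ z) ⊛ (theta z Q n ⊛ Q ↑ n ⊛ ρ n)
        ≈⟨ ⊛-congˡ (one ⊖ z) (⊛-congʳ (ρ n) (theta-scale z Q Q n)) ⟨
      (one ⊖ z) ⊛ (theta (z ⊛ Q) Q n ⊛ ρ n) ∎

  euler-iterate : ∀ {z} → Ord 1 z → ∀ K → euler z ≗ poch z Q K ⊛ euler (z ⊛ Q ↑ K)
  euler-iterate {z} oz zero    = ≗-trans
    (euler-cong (solve 1 (λ z → z := z :* con 1ℤ) ≗-refl z)) (≗-sym (⊛-identityˡ (euler (z ⊛ one))))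
  euler-iterate {z} oz (suc K) = begin
    euler z
      ≈⟨ euler-iterate oz K ⟩
    poch z Q K ⊛ euler (z ⊛ Q ↑ K)
      ≈⟨ ⊛-congˡ (poch z Q K) (euler-step (Ord-⊛ˡ (Q ↑ K) oz)) ⟩
    poch z Q K ⊛ ((one ⊖ z ⊛ Q ↑ K) ⊛ euler (z ⊛ Q ↑ K ⊛ Q))
      ≈⟨ ⊛-assoc (poch z Q K) (one ⊖ z ⊛ Q ↑ K) (euler (z ⊛ Q ↑ K ⊛ Q)) ⟨
    poch z Q (suc K) ⊛ euler (z ⊛ Q ↑ K ⊛ Q)
      ≈⟨ ⊛-congˡ (poch z Q (suc K)) (euler-cong
           (solve 3 (λ z K Q → z :* K :* Q := z :* (Q :* K)) ≗-refl z (Q ↑ K) Q)) ⟩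
    poch z Q (suc K) ⊛ euler (z ⊛ (Q ⊛ Q ↑ K)) ∎
    where open ≗-Reasoning

  euler-limit : ∀ {N z} → Ord 1 z → Ord N z → euler z ≈[ N ] one
  euler-limit {N} {z} oz oz′ = ≈-trans
    (Σ∞≈head (euler-summable oz) (λ k →
      Ord-⊛ˡ (ρ (suc k)) (Ord-⊝ (Ord-⊛ʳ (theta z Q k) (Ord-⊛ˡ (Q ↑ k) oz′)))))
    (≗⇒≈ (≗-trans (⊛-identityˡ (ρ 0)) (rpoch-0 Ord-Q)))

  euler-product : ∀ {z} → Ord 1 z → euler z ≗ poch∞ z Q
  euler-product {z} oz = ≈⇒≗ λ N → let open ≈-Reasoning N in begin
    euler z                            ≈⟨ ≗⇒≈ (euler-iterate oz N) ⟩
    poch z Q N ⊛ euler (z ⊛ Q ↑ N)     ≈⟨ ⊛-modˡ (poch z Q N)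
                                            (euler-limit (Ord-⊛ˡ (Q ↑ N) oz) (Ord-⊛ʳ z (Ord-↑ Ord-Q N))) ⟩
    poch z Q N ⊛ one                   ≈⟨ ≗⇒≈ (≗-trans (⊛-comm (poch z Q N) one) (⊛-identityˡ (poch z Q N))) ⟩
    poch z Q N                         ≈⟨ poch∞≈poch z Ord-Q ℕₚ.≤-refl ⟨
    poch∞ z Q                          ∎

  conv-weight : ∀ F G m → conv (λ s → Q ↑ s ⊛ F s) (λ k → Q ↑ k ⊛ G k) m ≗ Q ↑ m ⊛ conv F G m
  conv-weight F G zero    = solve 2 (λ f g → con 1ℤ :* f :* (con 1ℤ :* g) := con 1ℤ :* (f :* g)) ≗-refl (F 0) (G 0)
  conv-weight F G (suc m) = begin
    a ⊕ conv (λ s → Q ⊛ Q ↑ s ⊛ F (suc s)) σ m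
      ≈⟨ ⊕-congˡ a (conv-cong σ (λ s → ⊛-assoc Q (Q ↑ s) (F (suc s))) m) ⟩
    a ⊕ conv (λ s → Q ⊛ (Q ↑ s ⊛ F (suc s))) σ m
      ≈⟨ ⊕-congˡ a (conv-scale Q (λ s → Q ↑ s ⊛ F (suc s)) σ m) ⟩
    a ⊕ Q ⊛ conv (λ s → Q ↑ s ⊛ F (suc s)) σ m
      ≈⟨ ⊕-congˡ a (⊛-congˡ Q (conv-weight (F ∘ suc) G m)) ⟩
    a ⊕ Q ⊛ (Q ↑ m ⊛ conv (F ∘ suc) G m)
      ≈⟨ solve 5 (λ f Q M g c → con 1ℤ :* f :* (Q :* M :* g) :+ Q :* (M :* c) := Q :* M :* (f :* g :+ c)) ≗-refl
           (F 0) Q (Q ↑ m) (G (suc m)) (conv (F ∘ suc) G m) ⟩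
    Q ↑ suc m ⊛ conv F G (suc m) ∎
    where
    open ≗-Reasoning
    σ : ℕ → Series
    σ k = Q ↑ k ⊛ G k
    a = one ⊛ F 0 ⊛ (Q ↑ suc m ⊛ G (suc m))

  ρ-split : ∀ n → ρ (suc n) ≗ ρ n ⊕ Q ↑ suc n ⊛ ρ (suc n)
  ρ-split n = ≗-trans
    (solve 2 (λ Q r → r := (con 1ℤ :- Q) :* r :+ Q :* r) ≗-refl (Q ↑ suc n) (ρ (suc n)))
    (⊕-congʳ (Q ↑ suc n ⊛ ρ (suc n)) (rpoch-suc Ord-Q n))

  -- Lowering the index of ρ costs a factor 1 - Q^k.
  conv-ρ-suc : ∀ F m → conv F ρ (suc m) ≗ conv F ρ m ⊕ conv F (λ k → Q ↑ k ⊛ ρ k) (suc m)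
  conv-ρ-suc F zero    = ≗-trans
    (⊕-congʳ (F 1 ⊛ ρ 0) (⊛-congˡ (F 0) (ρ-split 0)))
    (solve 5 (λ a b r s t → a :* (r :+ s) :+ b :* t := a :* r :+ (a :* s :+ b :* (con 1ℤ :* t))) ≗-refl
      (F 0) (F 1) (ρ 0) (Q ↑ 1 ⊛ ρ 1) (ρ 0))
  conv-ρ-suc F (suc m) = ≗-trans
    (+-cong (⊛-congˡ (F 0) (ρ-split (suc m))) (conv-ρ-suc (F ∘ suc) m))
    (solve 5 (λ a r s c d → a :* (r :+ s) :+ (c :+ d) := (a :* r :+ c) :+ (a :* s :+ d)) ≗-refl
      (F 0) (ρ (suc m)) (Q ↑ suc (suc m) ⊛ ρ (suc (suc m))) (conv (F ∘ suc) ρ m)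
      (conv (F ∘ suc) (λ k → Q ↑ k ⊛ ρ k) (suc m)))

  module _ {x y : Series} (Ord-x : Ord 1 x) (Ord-y : Ord 1 y) (xy : x ⊛ y ≗ Q) where

    private
      θx = theta x Q
      θy = theta y Q

    -- The parts r ≥ 0 and r < 0 of Σ (-1)^r x^r Q^(r(r-1)/2) / (Q;Q)_(m+r) over
    -- r ≥ -m are upperHalf m and, for positive m, lowerHalf (m - 1); the terms of
    -- negative index r = -s are rewritten by x^(-s) Q^(s(s+1)/2) = y^s Q^(s(s-1)/2).
    upperHalf : ℕ → Series
    upperHalf m = Σ∞ (λ r → θx r ⊛ ρ (m ℕ.+ r))

    upperHalf-summable : ∀ m → Summable (λ r → θx r ⊛ ρ (m ℕ.+ r))
    upperHalf-summable m r = Ord-⊛ˡ (ρ (m ℕ.+ r)) (theta-summable Ord-x r)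

    lowerHalf : ℕ → Series
    lowerHalf = conv (θy ∘ suc) ρ

    -- The boundary term y Q^m / (Q;Q)_m cancels that of lowerHalf-suc.
    upperHalf-suc : ∀ m → upperHalf (suc m) ≗ (one ⊖ y ⊛ Q ↑ m) ⊛ upperHalf m ⊕ y ⊛ Q ↑ m ⊛ ρ m
    upperHalf-suc m = begin
      upperHalf (suc m)
        ≈⟨ solve 4 (λ a c s r → a := (a :+ c :* s) :- c :* (r :+ s) :+ c :* r) ≗-refl
             (upperHalf (suc m)) c S (ρ m) ⟩
      (upperHalf (suc m) ⊕ c ⊛ S) ⊖ c ⊛ (ρ m ⊕ S) ⊕ c ⊛ ρ m
        ≈⟨ ⊕-congʳ (c ⊛ ρ m) (⊖-cong shift (⊛-congˡ c head)) ⟨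
      upperHalf m ⊖ c ⊛ upperHalf m ⊕ c ⊛ ρ m
        ≈⟨ solve 3 (λ a c r → a :- c :* a :+ c :* r := (con 1ℤ :- c) :* a :+ c :* r) ≗-refl (upperHalf m) c (ρ m) ⟩
      (one ⊖ c) ⊛ upperHalf m ⊕ c ⊛ ρ m ∎
      where
      open ≗-Reasoning
      c = y ⊛ Q ↑ m
      f : ℕ → Series
      f r = θx r ⊛ ρ (m ℕ.+ r)
      S = Σ∞ (f ∘ suc)
      head : upperHalf m ≗ ρ m ⊕ S
      head = ≗-trans (Σ∞-suc (upperHalf-summable m)) (⊕-congʳ S (first m))
        where
        first : ∀ m → one ⊛ ρ (m ℕ.+ 0) ≗ ρ m
        first m rewrite ℕₚ.+-identityʳ m = ⊛-identityˡ (ρ m)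
      shift : upperHalf m ≗ upperHalf (suc m) ⊕ c ⊛ S
      shift = begin
        upperHalf m
          ≈⟨ Σ∞-cong term ⟩
        Σ∞ (λ r → θx r ⊛ ρ (suc m ℕ.+ r) ⊕ c ⊛ f (suc r))
          ≈⟨ Σ∞-⊕ (λ r → θx r ⊛ ρ (suc m ℕ.+ r)) (λ r → c ⊛ f (suc r)) ⟨
        upperHalf (suc m) ⊕ Σ∞ (λ r → c ⊛ f (suc r))
          ≈⟨ ⊕-congˡ (upperHalf (suc m)) (Σ∞-⊛ c (Summable-suc (upperHalf-summable m))) ⟨
        upperHalf (suc m) ⊕ c ⊛ S ∎
        where
        term : ∀ r → f r ≗ θx r ⊛ ρ (suc m ℕ.+ r) ⊕ c ⊛ f (suc r)
        term r rewrite ℕₚ.+-suc m r = begin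
          θx r ⊛ ρ (m ℕ.+ r)
            ≈⟨ ⊛-congˡ (θx r) (rpoch-suc Ord-Q (m ℕ.+ r)) ⟨
          θx r ⊛ ((one ⊖ Q ⊛ Q ↑ (m ℕ.+ r)) ⊛ R)
            ≈⟨ ⊛-congˡ (θx r) (⊛-congʳ R (⊖-cong (≗-refl {one}) (⊛-cong (≗-sym xy) (↑-+ Q m r)))) ⟩
          θx r ⊛ ((one ⊖ x ⊛ y ⊛ (Q ↑ m ⊛ Q ↑ r)) ⊛ R)
            ≈⟨ solve 6 (λ t x y M N R → t :* ((con 1ℤ :- x :* y :* (M :* N)) :* R)
                 := t :* R :+ y :* M :* (:- (t :* (x :* N)) :* R)) ≗-refl (θx r) x y (Q ↑ m) (Q ↑ r) R ⟩
          θx r ⊛ R ⊕ c ⊛ (θx (suc r) ⊛ R) ∎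
          where R = ρ (suc (m ℕ.+ r))

    lowerHalf-suc : ∀ m → lowerHalf (suc m) ≗ (one ⊖ y ⊛ Q ↑ suc m) ⊛ lowerHalf m ⊖ y ⊛ Q ↑ suc m ⊛ ρ (suc m)
    lowerHalf-suc m = begin
      lowerHalf (suc m)
        ≈⟨ conv-ρ-suc (θy ∘ suc) m ⟩
      lowerHalf m ⊕ conv (θy ∘ suc) σ (suc m)
        ≈⟨ ⊕-congˡ (lowerHalf m) (conv-cong σ (λ s →
             solve 3 (λ t y N → :- (t :* (y :* N)) := :- y :* (N :* t)) ≗-refl (θy s) y (Q ↑ s)) (suc m)) ⟩
      lowerHalf m ⊕ conv (λ s → ⊝ y ⊛ (Q ↑ s ⊛ θy s)) σ (suc m)
        ≈⟨ ⊕-congˡ (lowerHalf m) (≗-trans (conv-scale (⊝ y) (λ s → Q ↑ s ⊛ θy s) σ (suc m))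
             (⊛-congˡ (⊝ y) (conv-weight θy ρ (suc m)))) ⟩
      lowerHalf m ⊕ ⊝ y ⊛ (Q ↑ suc m ⊛ (one ⊛ ρ (suc m) ⊕ lowerHalf m))
        ≈⟨ solve 4 (λ l y M r → l :+ :- y :* (M :* (con 1ℤ :* r :+ l))
             := (con 1ℤ :- y :* M) :* l :- y :* M :* r) ≗-refl (lowerHalf m) y (Q ↑ suc m) (ρ (suc m)) ⟩
      (one ⊖ y ⊛ Q ↑ suc m) ⊛ lowerHalf m ⊖ y ⊛ Q ↑ suc m ⊛ ρ (suc m) ∎
      where
      open ≗-Reasoning
      σ : ℕ → Series
      σ k = Q ↑ k ⊛ ρ k

    -- The sum over all r ≥ -(m + 1), in closed form.
    semifinite : ∀ m → upperHalf (suc m) ⊕ lowerHalf m ≗ poch∞ x Q ⊛ poch y Q (suc m)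
    semifinite zero    = begin
      upperHalf 1 ⊕ lowerHalf 0
        ≈⟨ ⊕-congʳ (lowerHalf 0) (upperHalf-suc 0) ⟩
      (one ⊖ y ⊛ one) ⊛ upperHalf 0 ⊕ y ⊛ one ⊛ ρ 0 ⊕ ⊝ (one ⊛ (y ⊛ one)) ⊛ ρ 0
        ≈⟨ solve 3 (λ u y r → (con 1ℤ :- y :* con 1ℤ) :* u :+ y :* con 1ℤ :* r :+ :- (con 1ℤ :* (y :* con 1ℤ)) :* r
             := u :* (con 1ℤ :* (con 1ℤ :- y :* con 1ℤ))) ≗-refl (upperHalf 0) y (ρ 0) ⟩
      upperHalf 0 ⊛ poch y Q 1
        ≈⟨ ⊛-congʳ (poch y Q 1) (euler-product Ord-x) ⟩
      poch∞ x Q ⊛ poch y Q 1 ∎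
      where open ≗-Reasoning
    semifinite (suc m) = begin
      upperHalf (suc (suc m)) ⊕ lowerHalf (suc m)
        ≈⟨ +-cong (upperHalf-suc (suc m)) (lowerHalf-suc m) ⟩
      (one ⊖ c) ⊛ upperHalf (suc m) ⊕ c ⊛ ρ (suc m) ⊕ ((one ⊖ c) ⊛ lowerHalf m ⊖ c ⊛ ρ (suc m))
        ≈⟨ solve 4 (λ c u l r → (con 1ℤ :- c) :* u :+ c :* r :+ ((con 1ℤ :- c) :* l :- c :* r)
             := (u :+ l) :* (con 1ℤ :- c)) ≗-refl c (upperHalf (suc m)) (lowerHalf m) (ρ (suc m)) ⟩
      (upperHalf (suc m) ⊕ lowerHalf m) ⊛ (one ⊖ c)
        ≈⟨ ⊛-congʳ (one ⊖ c) (semifinite m) ⟩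
      poch∞ x Q ⊛ poch y Q (suc m) ⊛ (one ⊖ c)
        ≈⟨ ⊛-assoc (poch∞ x Q) (poch y Q (suc m)) (one ⊖ c) ⟩
      poch∞ x Q ⊛ poch y Q (suc (suc m)) ∎
      where
      open ≗-Reasoning
      c = y ⊛ Q ↑ suc m

    ρ-limit : ∀ {N k} → N ≤ k → poch∞ Q Q ⊛ ρ k ≈[ N ] one
    ρ-limit {k = k} N≤k = ≈-trans (⊛-modʳ (ρ k) (poch∞≈poch Q Ord-Q N≤k)) (≗⇒≈ (rpoch-inverse Ord-Q k))

    -- The Jacobi triple product: multiply semifinite by (Q;Q)_∞ and let m grow.
    triple-product : poch∞ x Q ⊛ poch∞ y Q ⊛ poch∞ Q Q ≗ Θ x y Q
    triple-product = ≈⇒≗ λ N → let open ≈-Reasoning N in begin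
      poch∞ x Q ⊛ poch∞ y Q ⊛ P
        ≈⟨ ⊛-modʳ P (⊛-modˡ (poch∞ x Q) (poch∞≈poch y Ord-Q (ℕₚ.n≤1+n N))) ⟩
      poch∞ x Q ⊛ poch y Q (suc N) ⊛ P
        ≈⟨ ≗⇒≈ (⊛-congʳ P (semifinite N)) ⟨
      (upperHalf (suc N) ⊕ lowerHalf N) ⊛ P
        ≈⟨ ≗⇒≈ (solve 3 (λ u l p → (u :+ l) :* p := p :* u :+ p :* l) ≗-refl (upperHalf (suc N)) (lowerHalf N) P) ⟩
      P ⊛ upperHalf (suc N) ⊕ P ⊛ lowerHalf N
        ≈⟨ ⊕-mod (upperHalf-limit N) (lowerHalf-limit N) ⟩
      Σ∞ θx ⊕ Σ∞ (θy ∘ suc)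
        ≈⟨ ≗⇒≈ (Σ∞-⊕ θx (θy ∘ suc)) ⟩
      Θ x y Q ∎
      where
      P = poch∞ Q Q
      upperHalf-limit : ∀ N → P ⊛ upperHalf (suc N) ≈[ N ] Σ∞ θx
      upperHalf-limit N = ≈-trans (≗⇒≈ (Σ∞-⊛ P (upperHalf-summable (suc N)))) (Σ∞-mod λ r → ≈-trans
        (≗⇒≈ (solve 3 (λ p t r → p :* (t :* r) := t :* (p :* r)) ≗-refl P (θx r) (ρ (suc N ℕ.+ r))))
        (≈-trans (⊛-modˡ (θx r) (ρ-limit (ℕₚ.≤-trans (ℕₚ.n≤1+n N) (ℕₚ.m≤m+n (suc N) r))))
          (≗⇒≈ (≗-trans (⊛-comm (θx r) one) (⊛-identityˡ (θx r))))))
      lowerHalf-limit : ∀ N → P ⊛ lowerHalf N ≈[ N ] Σ∞ (θy ∘ suc)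
      lowerHalf-limit N = let open ≈-Reasoning N in begin
        P ⊛ lowerHalf N                               ≈⟨ ≗⇒≈ (conv-scaleʳ P (θy ∘ suc) ρ N) ⟨
        conv (θy ∘ suc) (λ k → P ⊛ ρ k) N         ≈⟨ conv-limit 0 summable (λ k → ρ-limit ℕₚ.≤-refl) N ⟩
        psum (θy ∘ suc) (suc N)                   ≈⟨ ≈-weaken (ℕₚ.n≤1+n N) (Σ∞≈psum summable (suc N)) ⟨
        Σ∞ (θy ∘ suc)                             ∎
        where
        summable : Summable (θy ∘ suc)
        summable = Summable-suc (theta-summable Ord-y)

-- Copartitions

sum-replicate : ∀ k x → sum (replicate k x) ≡ k ℕ.* x
sum-replicate zero    x = refl
sum-replicate (suc k) x = cong (x ℕ.+_) (sum-replicate k x)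

replicate-partition : ∀ k x → 0 < x → IsPartition (replicate k x)
replicate-partition k x 0<x = linked k , Allₚ.replicate⁺ k 0<x
  where
  linked : ∀ k → Linked _≥_ (replicate k x)
  linked zero          = []
  linked (suc zero)    = [-]
  linked (suc (suc k)) = ℕₚ.≤-refl ∷ linked (suc k)

module _ (m : ℕ) .{{_ : NonZero m}} where

  -- The next number after a in its residue class is a + m.
  inClass-gap : ∀ {a x} → InClass a m x → x ≢ a → InClass (a ℕ.+ m) m x
  inClass-gap {a} {x} (a≤x , e) x≢a = far , trans e (sym ([m+n]%n≡m%n a m))
    where
    open ℕₚ.≤-Reasoning
    a/m<x/m : a / m < x / m
    a/m<x/m = ℕₚ.≰⇒> λ x/m≤a/m → x≢a (ℕₚ.≤-antisym (begin
      x                       ≡⟨ m≡m%n+[m/n]*n x m ⟩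
      x % m ℕ.+ x / m ℕ.* m   ≤⟨ ℕₚ.+-mono-≤ (ℕₚ.≤-reflexive e) (ℕₚ.*-monoˡ-≤ m x/m≤a/m) ⟩
      a % m ℕ.+ a / m ℕ.* m   ≡⟨ m≡m%n+[m/n]*n a m ⟨
      a                       ∎) a≤x)
    far : a ℕ.+ m ≤ x
    far = begin
      a ℕ.+ m                          ≡⟨ cong (ℕ._+ m) (m≡m%n+[m/n]*n a m) ⟩
      a % m ℕ.+ a / m ℕ.* m ℕ.+ m      ≡⟨ solveℕ 3 (λ r k m → r :+ℕ k :*ℕ m :+ℕ m :=ℕ r :+ℕ (conℕ 1 :+ℕ k) :*ℕ m) refl (a % m) (a / m) m ⟩
      a % m ℕ.+ suc (a / m) ℕ.* m      ≤⟨ ℕₚ.+-mono-≤ (ℕₚ.≤-reflexive (sym e)) (ℕₚ.*-monoˡ-≤ m a/m<x/m) ⟩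
      x % m ℕ.+ x / m ℕ.* m            ≡⟨ m≡m%n+[m/n]*n x m ⟨
      x                                ∎

  inClass-raise : ∀ {b x} → InClass b m x → InClass (b ℕ.+ m) m (x ℕ.+ m)
  inClass-raise {b} {x} (b≤x , e) = ℕₚ.+-monoˡ-≤ m b≤x ,
    trans ([m+n]%n≡m%n x m) (trans e (sym ([m+n]%n≡m%n b m)))

  inClass-lower : ∀ {b x} → InClass (b ℕ.+ m) m x → InClass b m (x ℕ.∸ m)
  inClass-lower {b} {x} (b+m≤x , e) = ℕₚ.m+n≤o⇒m≤o∸n b b+m≤x ,
    trans (m≤n⇒[n∸m]%m≡n%m (ℕₚ.m+n≤o⇒n≤o b b+m≤x)) (trans e ([m+n]%n≡m%n b m))

  inClass-weaken : ∀ {a x} → InClass (a ℕ.+ m) m x → InClass a m x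
  inClass-weaken {a} (a+m≤x , e) = ℕₚ.m+n≤o⇒m≤o a a+m≤x , trans e ([m+n]%n≡m%n a m)

  -- Weakly decreasing lists of numbers that are at least a and congruent to a
  -- modulo m.
  Class : ℕ → List ℕ → Set
  Class a xs = Linked _≥_ xs × All (InClass a m) xs

  class-irrelevant : ∀ {a xs} → Irrelevant (Class a xs)
  class-irrelevant = ×-irrelevant (Linked.irrelevant ℕₚ.≤-irrelevant)
    (All.irrelevant (×-irrelevant ℕₚ.≤-irrelevant ℕₚ.≡-irrelevant))

  class-snoc : ∀ {a xs} → Class a xs → Class a (xs ∷ʳ a)
  class-snoc {a} (l , c) = linked l c , Allₚ.∷ʳ⁺ c (ℕₚ.≤-refl , refl)
    where
    linked : ∀ {xs} → Linked _≥_ xs → All (InClass a m) xs → Linked _≥_ (xs ∷ʳ a)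
    linked []      []             = [-]
    linked [-]     ((a≤x , _) ∷ _) = a≤x ∷ [-]
    linked (r ∷ l) (_ ∷ c)        = r ∷ linked l c

  class-unsnoc : ∀ {a} xs {x} → Class a (xs ∷ʳ x) → Class a xs
  class-unsnoc xs (l , c) = linked xs l , proj₁ (Allₚ.∷ʳ⁻ c)
    where
    linked : ∀ xs {x} → Linked _≥_ (xs ∷ʳ x) → Linked _≥_ xs
    linked []           _       = []
    linked (_ ∷ [])     _       = [-]
    linked (_ ∷ y ∷ xs) (r ∷ l) = r ∷ linked (y ∷ xs) l

  class-raise : ∀ {b xs} → Class b xs → Class (b ℕ.+ m) (map (ℕ._+ m) xs)
  class-raise (l , c) = Linkedₚ.map⁺ (Linked.map (ℕₚ.+-monoˡ-≤ m) l) , Allₚ.map⁺ (All.map inClass-raise c)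

  class-lower : ∀ {b xs} → Class (b ℕ.+ m) xs → Class b (map (ℕ._∸ m) xs)
  class-lower (l , c) = Linkedₚ.map⁺ (Linked.map (ℕₚ.∸-monoˡ-≤ m) l) , Allₚ.map⁺ (All.map inClass-lower c)

  class-weaken : ∀ {a xs} → Class (a ℕ.+ m) xs → Class a xs
  class-weaken (l , c) = l , All.map inClass-weaken c

  lower-raise : ∀ xs → map (ℕ._∸ m) (map (ℕ._+ m) xs) ≡ xs
  lower-raise xs = trans (sym (Listₚ.map-∘ xs))
    (Listₚ.map-id-local (All.universal (λ x → ℕₚ.m+n∸n≡m x m) xs))

  raise-lower : ∀ {b xs} → Class (b ℕ.+ m) xs → map (ℕ._+ m) (map (ℕ._∸ m) xs) ≡ xs
  raise-lower {b} {xs} (_ , c) = trans (sym (Listₚ.map-∘ xs))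
    (Listₚ.map-id-local (All.map (λ (b+m≤x , _) → ℕₚ.m∸n+n≡m (ℕₚ.m+n≤o⇒n≤o b b+m≤x)) c))

  -- Either all parts exceed a, or the last part is a.
  LastPart : ℕ → List ℕ → Set
  LastPart a xs = Class (a ℕ.+ m) xs ⊎ ∃ λ ys → xs ≡ ys ∷ʳ a

  lastPart : ∀ {a xs} → Class a xs → LastPart a xs
  lastPart ([] , []) = inj₁ ([] , [])
  lastPart {a} {x ∷ []} ([-] , c ∷ []) with x ℕ.≟ a
  ... | yes refl = inj₂ ([] , refl)
  ... | no  x≢a  = inj₁ ([-] , inClass-gap c x≢a ∷ [])
  lastPart {a} {x ∷ y ∷ xs} (r ∷ l , c ∷ cs) with lastPart (l , cs)
  ... | inj₂ (ys , eq) = inj₂ (x ∷ ys , cong (x ∷_) eq)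
  ... | inj₁ (l′ , (a+m≤y , e) ∷ cs′) =
    inj₁ (r ∷ l′ , (ℕₚ.≤-trans a+m≤y r , trans (proj₂ c) (sym ([m+n]%n≡m%n a m))) ∷ (a+m≤y , e) ∷ cs′)

  lastPart-exclusive : ∀ {a xs} → ¬ Class (a ℕ.+ m) (xs ∷ʳ a)
  lastPart-exclusive {a} (_ , c) = ℕₚ.<⇒≱ (ℕₚ.m<m+n a (ℕₚ.n≢0⇒n>0 (ℕ.≢-nonZero⁻¹ m)))
    (proj₁ (proj₂ (Allₚ.∷ʳ⁻ c)))

  -- Copartitions as pairs (γ , σ): the partition ρ is determined by the rest.

  Lists : Set
  Lists = List ℕ × List ℕ

  -- The size of the copartition with given γ and σ.
  weight : Lists → ℕ
  weight (γ , σ) = sum γ ℕ.+ m ℕ.* (length γ ℕ.* length σ) ℕ.+ sum σ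

  -- Pairs (γ , σ) whose weight is n - d.  The offset d keeps track of a removed part
  -- without a subtraction.
  IsPair : (a b d n : ℕ) → Lists → Set
  IsPair a b d n (γ , σ) = Class a γ × Class b σ × d ℕ.+ weight (γ , σ) ≡ n

  Pair : (a b d n : ℕ) → Set
  Pair a b d n = Σ Lists (IsPair a b d n)

  pair-≡ : ∀ {a b} d {n} {s t : Pair a b d n} → proj₁ s ≡ proj₁ t → s ≡ t
  pair-≡ d {s = p , c} {.p , c′} refl = cong (p ,_)
    (×-irrelevant class-irrelevant (×-irrelevant class-irrelevant ℕₚ.≡-irrelevant) c c′)

  -- The partition ρ belonging to γ and σ.
  rectangle : List ℕ → List ℕ → List ℕ
  rectangle []        σ = []
  rectangle γ@(_ ∷ _) σ = replicate (length σ) (m ℕ.* length γ)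

  sum-rectangle : ∀ γ σ → sum (rectangle γ σ) ≡ m ℕ.* (length γ ℕ.* length σ)
  sum-rectangle []        σ = sym (ℕₚ.*-zeroʳ m)
  sum-rectangle γ@(_ ∷ _) σ = trans (sum-replicate (length σ) (m ℕ.* length γ))
    (solveℕ 3 (λ s m g → s :*ℕ (m :*ℕ g) :=ℕ m :*ℕ (g :*ℕ s)) refl (length σ) m (length γ))

  rectangle-partition : ∀ γ σ → IsPartition (rectangle γ σ)
  rectangle-partition []        σ = [] , []
  rectangle-partition γ@(_ ∷ _) σ = replicate-partition (length σ) (m ℕ.* length γ)
    (ℕₚ.*-mono-≤ (ℕₚ.n≢0⇒n>0 (ℕ.≢-nonZero⁻¹ m)) (s≤s z≤n))

  rectangle-condition : ∀ γ σ → RhoCondition m γ (rectangle γ σ) σ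
  rectangle-condition []      σ = refl
  rectangle-condition (_ ∷ _) σ = Listₚ.length-replicate (length σ) , Allₚ.replicate⁺ (length σ) refl

  rectangle-unique : ∀ γ ρ σ → RhoCondition m γ ρ σ → rectangle γ σ ≡ ρ
  rectangle-unique []      ρ σ eq       = sym eq
  rectangle-unique (_ ∷ _) ρ σ (eq , c) rewrite sym eq = constant c
    where
    constant : ∀ {x ys} → All (_≡ x) ys → replicate (length ys) x ≡ ys
    constant []         = refl
    constant (refl ∷ c) = cong (_ ∷_) (constant c)

  copartition↔pair : ∀ {a b n} → 0 < a → 0 < b → CopartitionOf a b m n ↔ Pair a b 0 n
  copartition↔pair {a} {b} {n} 0<a 0<b = mk↔ₛ′ to from (λ _ → pair-≡ 0 refl) from∘to
    where
    to : CopartitionOf a b m n → Pair a b 0 n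
    to ((γ , ρ , σ) , (((lγ , _) , _ , (lσ , _)) , cγ , cσ , r) , eq) =
      (γ , σ) , (lγ , cγ) , (lσ , cσ) ,
      trans (cong (λ z → sum γ ℕ.+ z ℕ.+ sum σ)
        (trans (sym (sum-rectangle γ σ)) (cong sum (rectangle-unique γ ρ σ r)))) eq
    from : Pair a b 0 n → CopartitionOf a b m n
    from ((γ , σ) , (lγ , cγ) , (lσ , cσ) , eq) =
      (γ , rectangle γ σ , σ) ,
      (((lγ , positive 0<a cγ) , rectangle-partition γ σ , (lσ , positive 0<b cσ)) ,
        cγ , cσ , rectangle-condition γ σ) ,
      trans (cong (λ z → sum γ ℕ.+ z ℕ.+ sum σ) (sum-rectangle γ σ)) eq
      where
      positive : ∀ {c xs} → 0 < c → All (InClass c m) xs → All (0 <_) xs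
      positive 0<c = All.map (λ (c≤x , _) → ℕₚ.≤-trans 0<c c≤x)
    from∘to : ∀ c → from (to c) ≡ c
    from∘to c@(t@(γ , ρ , σ) , p@((_ , _ , _ , r) , _)) =
      ext (cong (λ z → γ , z , σ) (rectangle-unique γ ρ σ r))
      where
      ext : ∀ {s t : CopartitionOf a b m n} → proj₁ s ≡ proj₁ t → s ≡ t
      ext {t , c} {.t , c′} refl = cong (t ,_) (isCopartitionOf-irrelevant a b m n t c c′)

  cp↔pair : ∀ {a b} n → 0 < a → 0 < b → Fin (cp a b m n) ↔ Pair a b 0 n
  cp↔pair {a} {b} n 0<a 0<b = ↔-trans (cp-correct a b m n) (copartition↔pair 0<a 0<b)

  pair-swap : ∀ {a b n} → Pair a b 0 n ↔ Pair b a 0 n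
  pair-swap = mk↔ₛ′ swap swap (λ _ → pair-≡ 0 refl) (λ _ → pair-≡ 0 refl)
    where
    swap : ∀ {a b n} → Pair a b 0 n → Pair b a 0 n
    swap ((γ , σ) , cγ , cσ , eq) = (σ , γ) , cσ , cγ , trans
      (solveℕ 5 (λ s t m g h → t :+ℕ m :*ℕ (h :*ℕ g) :+ℕ s :=ℕ s :+ℕ m :*ℕ (g :*ℕ h) :+ℕ t) refl
        (sum γ) (sum σ) m (length γ) (length σ)) eq

  sum-raise : ∀ xs → sum (map (ℕ._+ m) xs) ≡ sum xs ℕ.+ length xs ℕ.* m
  sum-raise []       = refl
  sum-raise (x ∷ xs) rewrite sum-raise xs =
    solveℕ 4 (λ x m s k → x :+ℕ m :+ℕ (s :+ℕ k :*ℕ m) :=ℕ x :+ℕ s :+ℕ (m :+ℕ k :*ℕ m)) refl x m (sum xs) (length xs)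

  weight-snoc : ∀ a γ σ → a ℕ.+ weight (γ , map (ℕ._+ m) σ) ≡ weight (γ ∷ʳ a , σ)
  weight-snoc a γ σ
    rewrite sum-++ γ (a ∷ []) | Listₚ.length-++ γ {a ∷ []} | Listₚ.length-map (ℕ._+ m) σ | sum-raise σ =
    solveℕ 6 (λ a s t m g h → a :+ℕ (s :+ℕ m :*ℕ (g :*ℕ h) :+ℕ (t :+ℕ h :*ℕ m))
                          :=ℕ s :+ℕ (a :+ℕ conℕ 0) :+ℕ m :*ℕ ((g :+ℕ conℕ 1) :*ℕ h) :+ℕ t) refl
      a (sum γ) (sum σ) m (length γ) (length σ)

  -- The bijection behind the q-difference equation: if a is a part of γ, remove it
  -- and add m to every part of σ.  The number of parts of γ drops by one, so this
  -- takes m from every part of ρ, one for each part of σ, and the weight changes by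
  -- exactly a.
  pair-step : ∀ {a b n} → Pair a b 0 n ↔ (Pair (a ℕ.+ m) b 0 n ⊎ Pair a (b ℕ.+ m) a n)
  pair-step {a} {b} {n} = mk↔ₛ′ to from to∘from from∘to
    where
    to′ : (p : Pair a b 0 n) → LastPart a (proj₁ (proj₁ p)) → Pair (a ℕ.+ m) b 0 n ⊎ Pair a (b ℕ.+ m) a n
    to′ ((γ , σ) , cγ , cσ , eq) (inj₁ cγ′)       = inj₁ ((γ , σ) , cγ′ , cσ , eq)
    to′ ((γ , σ) , cγ , cσ , eq) (inj₂ (γ′ , γ≡)) = inj₂ ((γ′ , map (ℕ._+ m) σ) ,
      class-unsnoc γ′ (subst (Class a) γ≡ cγ) , class-raise cσ ,
      trans (weight-snoc a γ′ σ) (trans (cong (λ z → weight (z , σ)) (sym γ≡)) eq))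

    to : Pair a b 0 n → Pair (a ℕ.+ m) b 0 n ⊎ Pair a (b ℕ.+ m) a n
    to p@(_ , cγ , _) = to′ p (lastPart cγ)

    from : Pair (a ℕ.+ m) b 0 n ⊎ Pair a (b ℕ.+ m) a n → Pair a b 0 n
    from (inj₁ ((γ , σ) , cγ , cσ , eq)) = (γ , σ) , class-weaken cγ , cσ , eq
    from (inj₂ ((γ , σ) , cγ , cσ , eq)) = (γ ∷ʳ a , map (ℕ._∸ m) σ) , class-snoc cγ , class-lower cσ ,
      trans (sym (weight-snoc a γ (map (ℕ._∸ m) σ)))
        (trans (cong (λ z → a ℕ.+ weight (γ , z)) (raise-lower cσ)) eq)

    to′∘from : ∀ s l → to′ (from s) l ≡ s
    to′∘from (inj₁ (_ , cγ , _)) (inj₁ _)         = cong inj₁ (pair-≡ 0 refl)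
    to′∘from (inj₁ (_ , cγ , _)) (inj₂ (γ′ , γ≡)) = ⊥-elim (lastPart-exclusive (subst (Class (a ℕ.+ m)) γ≡ cγ))
    to′∘from (inj₂ _)            (inj₁ cγ′)       = ⊥-elim (lastPart-exclusive cγ′)
    to′∘from (inj₂ ((γ , σ) , _ , cσ , _)) (inj₂ (γ′ , γ≡)) =
      cong inj₂ (pair-≡ a (cong₂ _,_ (sym (Listₚ.∷ʳ-injectiveˡ γ γ′ γ≡)) (raise-lower cσ)))

    to∘from : ∀ s → to (from s) ≡ s
    to∘from s = to′∘from s (lastPart (proj₁ (proj₂ (from s))))

    from∘to′ : ∀ p l → from (to′ p l) ≡ p
    from∘to′ p             (inj₁ _)         = pair-≡ 0 refl
    from∘to′ ((γ , σ) , _) (inj₂ (γ′ , γ≡)) = pair-≡ 0 (cong₂ _,_ (sym γ≡) (lower-raise σ))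

    from∘to : ∀ p → from (to p) ≡ p
    from∘to p = from∘to′ p (lastPart (proj₁ (proj₂ p)))

  pair-offset : ∀ {a b} d n → Pair a b d (d ℕ.+ n) ↔ Pair a b 0 n
  pair-offset d n = mk↔ₛ′
    (λ (p , cγ , cσ , eq) → p , cγ , cσ , ℕₚ.+-cancelˡ-≡ d (weight p) n eq)
    (λ (p , cγ , cσ , eq) → p , cγ , cσ , cong (d ℕ.+_) eq)
    (λ _ → pair-≡ 0 refl) (λ _ → pair-≡ d refl)

  pair-offset-> : ∀ {a b d n} → n < d → ¬ Pair a b d n
  pair-offset-> {d = d} n<d (p , _ , _ , eq) =
    ℕₚ.<⇒≱ n<d (ℕₚ.≤-trans (ℕₚ.m≤m+n d (weight p)) (ℕₚ.≤-reflexive eq))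

  cp-sym : ∀ {a b} → 0 < a → 0 < b → ∀ n → cp a b m n ≡ cp b a m n
  cp-sym 0<a 0<b n = ↔⇒≡ (↔-trans (cp↔pair n 0<a 0<b) (↔-trans pair-swap (↔-sym (cp↔pair n 0<b 0<a))))

  0<+ : ∀ {a} → 0 < a → 0 < a ℕ.+ m
  0<+ {a} 0<a = ℕₚ.≤-trans 0<a (ℕₚ.m≤m+n a m)

  cp-step : ∀ {a b} → 0 < a → 0 < b → ∀ n →
            cp a b m (a ℕ.+ n) ≡ cp (a ℕ.+ m) b m (a ℕ.+ n) ℕ.+ cp a (b ℕ.+ m) m n
  cp-step {a} {b} 0<a 0<b n = ↔⇒≡
    (↔-trans (cp↔pair (a ℕ.+ n) 0<a 0<b)
    (↔-trans pair-step
    (↔-trans (↔-sym (cp↔pair (a ℕ.+ n) (0<+ 0<a) 0<b) ⊎-↔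
              ↔-trans (pair-offset a n) (↔-sym (cp↔pair n 0<a (0<+ 0<b))))
    (↔-sym +↔⊎))))

  cp-skip : ∀ {a b} → 0 < a → 0 < b → ∀ {n} → n < a → cp a b m n ≡ cp (a ℕ.+ m) b m n
  cp-skip {a} {b} 0<a 0<b {n} n<a = ↔⇒≡
    (↔-trans (cp↔pair n 0<a 0<b)
    (↔-trans pair-step
    (↔-trans (mk↔ₛ′ (λ where (inj₁ p) → p ; (inj₂ p) → ⊥-elim (pair-offset-> n<a p)) inj₁ (λ _ → refl)
               (λ where (inj₁ p) → refl ; (inj₂ p) → ⊥-elim (pair-offset-> n<a p)))
    (↔-sym (cp↔pair n (0<+ 0<a) 0<b)))))

  pair-empty : ∀ {a b n} → n < a → n < b → (p : Pair a b 0 n) → proj₁ p ≡ ([] , [])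
  pair-empty n<a n<b (([] , []) , _) = refl
  pair-empty {a} {n = n} n<a n<b ((x ∷ γ , σ) , (_ , (a≤x , _) ∷ _) , _ , eq) =
    ⊥-elim (ℕₚ.<⇒≱ n<a (begin
      a                                          ≤⟨ a≤x ⟩
      x                                          ≤⟨ ℕₚ.m≤m+n x (sum γ) ⟩
      sum (x ∷ γ)                                ≤⟨ ℕₚ.m≤m+n (sum (x ∷ γ)) (m ℕ.* (length (x ∷ γ) ℕ.* length σ)) ⟩
      sum (x ∷ γ) ℕ.+ m ℕ.* (length (x ∷ γ) ℕ.* length σ)  ≤⟨ ℕₚ.m≤m+n _ (sum σ) ⟩
      weight (x ∷ γ , σ)                         ≡⟨ eq ⟩
      n                                          ∎))
    where open ℕₚ.≤-Reasoning
  pair-empty {b = b} {n} n<a n<b (([] , y ∷ σ) , _ , (_ , (b≤y , _) ∷ _) , eq) =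
    ⊥-elim (ℕₚ.<⇒≱ n<b (begin
      b                       ≤⟨ b≤y ⟩
      y                       ≤⟨ ℕₚ.m≤m+n y (sum σ) ⟩
      sum (y ∷ σ)             ≤⟨ ℕₚ.m≤n+m (sum (y ∷ σ)) (m ℕ.* 0) ⟩
      weight ([] , y ∷ σ)     ≡⟨ eq ⟩
      n                       ∎))
    where open ℕₚ.≤-Reasoning

  cpSeries-limit : ∀ {a b N} → 0 < a → 0 < b → N ≤ a → N ≤ b → cpSeries a b m ≈[ N ] one
  cpSeries-limit {a} {b} 0<a 0<b N≤a N≤b zero n<N = cong +_ (↔⇒≡ {n = 1} (↔-trans (cp↔pair 0 0<a 0<b)
    (mk↔ₛ′ (λ _ → Fin.zero)
      (λ _ → ([] , []) , ([] , []) , ([] , []) , trans (ℕₚ.+-identityʳ (m ℕ.* 0)) (ℕₚ.*-zeroʳ m))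
      unique
      (λ p → pair-≡ 0 (sym (pair-empty (ℕₚ.≤-trans n<N N≤a) (ℕₚ.≤-trans n<N N≤b) p))))))
    where
    unique : (i : Fin 1) → Fin.zero ≡ i
    unique Fin.zero = refl
  cpSeries-limit {a} {b} 0<a 0<b N≤a N≤b (suc n) n<N = cong +_ (↔⇒≡ {n = 0} (↔-trans (cp↔pair (suc n) 0<a 0<b)
    (mk↔ₛ′ (λ p → ⊥-elim (none p)) (λ ()) (λ ()) (λ p → ⊥-elim (none p)))))
    where
    contradictory : (p : Pair a b 0 (suc n)) → ¬ (proj₁ p ≡ ([] , []))
    contradictory (_ , _ , _ , eq) refl
      with () ← trans (sym (trans (ℕₚ.+-identityʳ (m ℕ.* 0)) (ℕₚ.*-zeroʳ m))) eq
    none : ¬ Pair a b 0 (suc n)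
    none p = contradictory p (pair-empty (ℕₚ.≤-trans n<N N≤a) (ℕₚ.≤-trans n<N N≤b) p)

  -- The product formula

  -- cp-step and cp-skip as an identity of generating functions.
  cpSeries-step : ∀ {a b} → 0 < a → 0 < b →
                  cpSeries a b m ≗ cpSeries (a ℕ.+ m) b m ⊕ q ↑ a ⊛ cpSeries a (b ℕ.+ m) m
  cpSeries-step {a} {b} 0<a 0<b n with n ℕ.<? a
  ... | yes n<a = trans (cong +_ (cp-skip 0<a 0<b n<a))
    (sym (trans (cong (ℤ._+_ (+ cp (a ℕ.+ m) b m n)) (Ord-⊛ˡ (cpSeries a (b ℕ.+ m) m) (Ord-q↑ a) n n<a))
      (ℤₚ.+-identityʳ _)))
  ... | no n≮a rewrite sym (ℕₚ.m+[n∸m]≡n (ℕₚ.≮⇒≥ n≮a)) = above (n ℕ.∸ a)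
    where
    above : ∀ k → cpSeries a b m (a ℕ.+ k) ≡
                  cpSeries (a ℕ.+ m) b m (a ℕ.+ k) ℤ.+ (q ↑ a ⊛ cpSeries a (b ℕ.+ m) m) (a ℕ.+ k)
    above k = begin
      + cp a b m (a ℕ.+ k)
        ≡⟨ cong +_ (cp-step 0<a 0<b k) ⟩
      + (cp (a ℕ.+ m) b m (a ℕ.+ k) ℕ.+ cp a (b ℕ.+ m) m k)
        ≡⟨ ℤₚ.pos-+ (cp (a ℕ.+ m) b m (a ℕ.+ k)) (cp a (b ℕ.+ m) m k) ⟩
      + cp (a ℕ.+ m) b m (a ℕ.+ k) ℤ.+ + cp a (b ℕ.+ m) m k
        ≡⟨ cong (ℤ._+_ (+ cp (a ℕ.+ m) b m (a ℕ.+ k))) (q↑-shift a (cpSeries a (b ℕ.+ m) m) k) ⟨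
      + cp (a ℕ.+ m) b m (a ℕ.+ k) ℤ.+ (q ↑ a ⊛ cpSeries a (b ℕ.+ m) m) (a ℕ.+ k) ∎
      where open ≡-Reasoning

  cpSeries-sym : ∀ {a b} → 0 < a → 0 < b → cpSeries a b m ≗ cpSeries b a m
  cpSeries-sym 0<a 0<b n = cong +_ (cp-sym 0<a 0<b n)

  -- Subtract q^a times the q-difference equation with the roles of a and b exchanged
  -- from the equation itself.
  cpSeries-factor : ∀ {a b} → 0 < a → 0 < b →
    (one ⊖ q ↑ a) ⊛ cpSeries a b m ≗ (one ⊖ q ↑ b ⊛ q ↑ a) ⊛ cpSeries (a ℕ.+ m) b m
  cpSeries-factor {a} {b} 0<a 0<b = begin
    (one ⊖ x) ⊛ W
      ≈⟨ solve 2 (λ x W → (con 1ℤ :- x) :* W := W :- x :* W) ≗-refl x W ⟩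
    W ⊖ x ⊛ W
      ≈⟨ ⊖-cong (cpSeries-step 0<a 0<b) (⊛-congˡ x step′) ⟩
    U ⊕ x ⊛ V ⊖ x ⊛ (V ⊕ y ⊛ U)
      ≈⟨ solve 4 (λ x y U V → U :+ x :* V :- x :* (V :+ y :* U) := (con 1ℤ :- y :* x) :* U) ≗-refl x y U V ⟩
    (one ⊖ y ⊛ x) ⊛ U ∎
    where
    open ≗-Reasoning
    x = q ↑ a
    y = q ↑ b
    W = cpSeries a b m
    U = cpSeries (a ℕ.+ m) b m
    V = cpSeries a (b ℕ.+ m) m
    step′ : W ≗ V ⊕ y ⊛ U
    step′ = begin
      W                                                       ≈⟨ cpSeries-sym 0<a 0<b ⟩
      cpSeries b a m                                          ≈⟨ cpSeries-step 0<b 0<a ⟩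
      cpSeries (b ℕ.+ m) a m ⊕ y ⊛ cpSeries b (a ℕ.+ m) m     ≈⟨ +-cong (cpSeries-sym (0<+ 0<b) 0<a)
                                                                   (⊛-congˡ y (cpSeries-sym 0<b (0<+ 0<a))) ⟩
      V ⊕ y ⊛ U                                               ∎

  cpSeries-iterate : ∀ {a b} → 0 < a → 0 < b → ∀ K →
    poch (q ↑ a) (q ↑ m) K ⊛ cpSeries a b m ≗
    poch (q ↑ b ⊛ q ↑ a) (q ↑ m) K ⊛ cpSeries (K ℕ.* m ℕ.+ a) b m
  cpSeries-iterate 0<a 0<b zero    = ≗-refl
  cpSeries-iterate {a} {b} 0<a 0<b (suc K) = begin
    poch x Q K ⊛ (one ⊖ x ⊛ Q ↑ K) ⊛ cpSeries a b m
      ≈⟨ solve 3 (λ p f c → p :* f :* c := f :* (p :* c)) ≗-refl (poch x Q K) (one ⊖ x ⊛ Q ↑ K) (cpSeries a b m) ⟩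
    (one ⊖ x ⊛ Q ↑ K) ⊛ (poch x Q K ⊛ cpSeries a b m)
      ≈⟨ ⊛-cong (⊖-cong (≗-refl {one}) power) (cpSeries-iterate 0<a 0<b K) ⟩
    (one ⊖ q ↑ a′) ⊛ (poch (y ⊛ x) Q K ⊛ cpSeries a′ b m)
      ≈⟨ solve 3 (λ p f c → f :* (p :* c) := p :* (f :* c)) ≗-refl (poch (y ⊛ x) Q K) (one ⊖ q ↑ a′) (cpSeries a′ b m) ⟩
    poch (y ⊛ x) Q K ⊛ ((one ⊖ q ↑ a′) ⊛ cpSeries a′ b m)
      ≈⟨ ⊛-congˡ (poch (y ⊛ x) Q K) (cpSeries-factor (ℕₚ.≤-trans 0<a (ℕₚ.m≤n+m a (K ℕ.* m))) 0<b) ⟩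
    poch (y ⊛ x) Q K ⊛ ((one ⊖ y ⊛ q ↑ a′) ⊛ cpSeries (a′ ℕ.+ m) b m)
      ≈⟨ ⊛-congˡ (poch (y ⊛ x) Q K) (⊛-cong
           (⊖-cong (≗-refl {one}) (≗-trans (⊛-congˡ y (≗-sym power)) (≗-sym (⊛-assoc y x (Q ↑ K)))))
           (λ n → cong (λ c → cpSeries c b m n) shift)) ⟩
    poch (y ⊛ x) Q K ⊛ ((one ⊖ y ⊛ x ⊛ Q ↑ K) ⊛ cpSeries (suc K ℕ.* m ℕ.+ a) b m)
      ≈⟨ ⊛-assoc (poch (y ⊛ x) Q K) (one ⊖ y ⊛ x ⊛ Q ↑ K) (cpSeries (suc K ℕ.* m ℕ.+ a) b m) ⟨
    poch (y ⊛ x) Q (suc K) ⊛ cpSeries (suc K ℕ.* m ℕ.+ a) b m ∎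
    where
    open ≗-Reasoning
    x = q ↑ a
    y = q ↑ b
    Q = q ↑ m
    a′ = K ℕ.* m ℕ.+ a
    power : x ⊛ Q ↑ K ≗ q ↑ a′
    power = ≗-sym (≗-trans (↑-+ q (K ℕ.* m) a) (≗-trans (⊛-congʳ x (↑-* q m K)) (⊛-comm (Q ↑ K) x)))
    shift : a′ ℕ.+ m ≡ suc K ℕ.* m ℕ.+ a
    shift = trans (ℕₚ.+-comm a′ m) (sym (ℕₚ.+-assoc m (K ℕ.* m) a))

  cpSeries-product : ∀ {a b} → 0 < a → 0 < b →
    poch∞ (q ↑ a) (q ↑ m) ⊛ poch∞ (q ↑ b) (q ↑ m) ⊛ cpSeries a b m ≗ poch∞ (q ↑ b ⊛ q ↑ a) (q ↑ m)
  cpSeries-product {a} {b} 0<a 0<b = ≈⇒≗ λ N →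
    let open ≈-Reasoning N
        a′ = N ℕ.* m ℕ.+ a
        b′ = N ℕ.* m ℕ.+ b
        N≤N*m = ℕₚ.m≤m*n N m
        N≤a′ = ℕₚ.≤-trans N≤N*m (ℕₚ.m≤m+n (N ℕ.* m) a)
        N≤b′ = ℕₚ.≤-trans N≤N*m (ℕₚ.m≤m+n (N ℕ.* m) b)
        0<a′ = ℕₚ.≤-trans 0<a (ℕₚ.m≤n+m a (N ℕ.* m))
        0<b′ = ℕₚ.≤-trans 0<b (ℕₚ.m≤n+m b (N ℕ.* m))
    in begin
    poch∞ x Q ⊛ poch∞ y Q ⊛ cpSeries a b m
      ≈⟨ ⊛-modʳ (cpSeries a b m) (⊛-mod (poch∞≈poch x Ord-Q (ℕₚ.≤-refl {N})) (poch∞≈poch y Ord-Q (ℕₚ.≤-refl {N}))) ⟩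
    poch x Q N ⊛ poch y Q N ⊛ cpSeries a b m
      ≈⟨ ≗⇒≈ (solve 3 (λ p r c → p :* r :* c := r :* (p :* c)) ≗-refl (poch x Q N) (poch y Q N) (cpSeries a b m)) ⟩
    poch y Q N ⊛ (poch x Q N ⊛ cpSeries a b m)
      ≈⟨ ≗⇒≈ (⊛-congˡ (poch y Q N) (≗-trans (cpSeries-iterate 0<a 0<b N)
           (⊛-congˡ (poch (y ⊛ x) Q N) (cpSeries-sym 0<a′ 0<b)))) ⟩
    poch y Q N ⊛ (poch (y ⊛ x) Q N ⊛ cpSeries b a′ m)
      ≈⟨ ≗⇒≈ (solve 3 (λ p r c → p :* (r :* c) := r :* (p :* c)) ≗-refl (poch y Q N) (poch (y ⊛ x) Q N) (cpSeries b a′ m)) ⟩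
    poch (y ⊛ x) Q N ⊛ (poch y Q N ⊛ cpSeries b a′ m)
      ≈⟨ ≗⇒≈ (⊛-congˡ (poch (y ⊛ x) Q N) (cpSeries-iterate 0<b 0<a′ N)) ⟩
    poch (y ⊛ x) Q N ⊛ (poch (q ↑ a′ ⊛ y) Q N ⊛ cpSeries b′ a′ m)
      ≈⟨ ⊛-modˡ (poch (y ⊛ x) Q N) (⊛-mod
           (poch-limit Q (Ord-⊛ˡ y (≈-weaken N≤a′ (Ord-q↑ a′))) N)
           (cpSeries-limit 0<b′ 0<a′ N≤b′ N≤a′)) ⟩
    poch (y ⊛ x) Q N ⊛ (one ⊛ one)
      ≈⟨ ≗⇒≈ (solve 1 (λ p → p :* (con 1ℤ :* con 1ℤ) := p) ≗-refl (poch (y ⊛ x) Q N)) ⟩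
    poch (y ⊛ x) Q N
      ≈⟨ poch∞≈poch (y ⊛ x) Ord-Q (ℕₚ.≤-refl {N}) ⟨
    poch∞ (y ⊛ x) Q ∎
    where
    x = q ↑ a
    y = q ↑ b
    Q = q ↑ m
    Ord-Q : Ord 1 Q
    Ord-Q = ≈-weaken (ℕₚ.n≢0⇒n>0 (ℕ.≢-nonZero⁻¹ m)) (Ord-q↑ m)

-- Modulus five

private
  Q₅ : Series
  Q₅ = q ↑ 5

  -- p i = (q^i;q^5)_∞
  p : ℕ → Series
  p i = poch∞ (q ↑ i) Q₅

Ord-q↑suc : ∀ k → Ord 1 (q ↑ suc k)
Ord-q↑suc k = ≈-weaken (s≤s z≤n) (Ord-q↑ (suc k))

-- The exponents are split according to their residues modulo 5.
poch-dissect : ∀ K → poch q q (K ℕ.* 5) ≗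
  poch (q ↑ 1) Q₅ K ⊛ poch (q ↑ 2) Q₅ K ⊛ poch (q ↑ 3) Q₅ K ⊛ poch (q ↑ 4) Q₅ K ⊛ poch (q ↑ 5) Q₅ K
poch-dissect zero    = solve 0 (con 1ℤ := con 1ℤ :* con 1ℤ :* con 1ℤ :* con 1ℤ :* con 1ℤ) ≗-refl
poch-dissect (suc K) = begin
  poch q q (K ℕ.* 5) ⊛ (one ⊖ q ⊛ w) ⊛ (one ⊖ q ⊛ (q ⊛ w)) ⊛ (one ⊖ q ⊛ (q ⊛ (q ⊛ w)))
    ⊛ (one ⊖ q ⊛ (q ⊛ (q ⊛ (q ⊛ w)))) ⊛ (one ⊖ q ⊛ (q ⊛ (q ⊛ (q ⊛ (q ⊛ w)))))
    ≈⟨ ⊛-cong (⊛-cong (⊛-cong (⊛-cong (⊛-cong (poch-dissect K)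
         (factor 1 (solve 2 (λ q w → q :* w := q :^ 1 :* w) ≗-refl q w)))
         (factor 2 (solve 2 (λ q w → q :* (q :* w) := q :^ 2 :* w) ≗-refl q w)))
         (factor 3 (solve 2 (λ q w → q :* (q :* (q :* w)) := q :^ 3 :* w) ≗-refl q w)))
         (factor 4 (solve 2 (λ q w → q :* (q :* (q :* (q :* w))) := q :^ 4 :* w) ≗-refl q w)))
         (factor 5 (solve 2 (λ q w → q :* (q :* (q :* (q :* (q :* w)))) := q :^ 5 :* w) ≗-refl q w)) ⟩
  pK 1 ⊛ pK 2 ⊛ pK 3 ⊛ pK 4 ⊛ pK 5 ⊛ f 1 ⊛ f 2 ⊛ f 3 ⊛ f 4 ⊛ f 5
    ≈⟨ solve 10 (λ p₁ p₂ p₃ p₄ p₅ f₁ f₂ f₃ f₄ f₅ →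
         p₁ :* p₂ :* p₃ :* p₄ :* p₅ :* f₁ :* f₂ :* f₃ :* f₄ :* f₅ :=
         (p₁ :* f₁) :* (p₂ :* f₂) :* (p₃ :* f₃) :* (p₄ :* f₄) :* (p₅ :* f₅)) ≗-refl
       (pK 1) (pK 2) (pK 3) (pK 4) (pK 5) (f 1) (f 2) (f 3) (f 4) (f 5) ⟩
  poch (q ↑ 1) Q₅ (suc K) ⊛ poch (q ↑ 2) Q₅ (suc K) ⊛ poch (q ↑ 3) Q₅ (suc K)
    ⊛ poch (q ↑ 4) Q₅ (suc K) ⊛ poch (q ↑ 5) Q₅ (suc K) ∎
  where
  open ≗-Reasoning
  w = q ↑ (K ℕ.* 5)
  pK f : ℕ → Series
  pK i = poch (q ↑ i) Q₅ K
  f i = one ⊖ q ↑ i ⊛ Q₅ ↑ K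
  factor : ∀ i {g} → g ≗ q ↑ i ⊛ w → one ⊖ g ≗ f i
  factor i e = ⊖-cong (≗-refl {one}) (≗-trans e (⊛-congˡ (q ↑ i) (↑-* q 5 K)))

poch∞-dissect : poch∞ q q ≗ p 1 ⊛ p 2 ⊛ p 3 ⊛ p 4 ⊛ p 5
poch∞-dissect = ≈⇒≗ λ N → ≈-trans
  (≈-trans (poch∞≈poch q Ord-q (ℕₚ.m≤m*n N 5)) (≗⇒≈ (poch-dissect N)))
  (≈-sym (⊛-mod (⊛-mod (⊛-mod (⊛-mod (lim N 1) (lim N 2)) (lim N 3)) (lim N 4)) (lim N 5)))
  where
  lim : ∀ N i → p i ≈[ N ] poch (q ↑ i) Q₅ N
  lim N i = poch∞≈poch (q ↑ i) (Ord-q↑suc 4) (ℕₚ.≤-refl {N})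

cpSeries-complementary : ∀ a b → 0 < a → 0 < b → b ℕ.+ a ≡ 5 → p a ⊛ p b ⊛ cpSeries a b 5 ≗ p 5
cpSeries-complementary a b 0<a 0<b b+a≡5 = ≗-trans (cpSeries-product 5 0<a 0<b) λ n →
  poch-cong Q₅ (≗-trans (≗-sym (↑-+ q b a)) (λ k → cong (λ c → (q ↑ c) k) b+a≡5)) (suc n) n

rogers-0-product : poch∞ q q ⊛ rogers 0 ≗ p 3 ⊛ p 2 ⊛ p 5
rogers-0-product = ≗-trans rogers-0-Θ (≗-sym
  (triple-product (Ord-q↑suc 4) (Ord-q↑suc 2) (Ord-q↑suc 1) (≗-sym (↑-+ q 3 2))))

rogers-1-product : poch∞ q q ⊛ rogers 1 ≗ p 4 ⊛ p 1 ⊛ p 5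
rogers-1-product = ≗-trans rogers-1-Θ (≗-sym
  (triple-product (Ord-q↑suc 4) (Ord-q↑suc 3) (Ord-q↑suc 0) (≗-sym (↑-+ q 4 1))))

-- Cancel p 1, …, p 4 and move p 5 to the right.
quotient : ∀ R C → p 1 ⊛ p 2 ⊛ p 3 ⊛ p 4 ⊛ (p 5 ⊛ R) ≗ p 1 ⊛ p 2 ⊛ p 3 ⊛ p 4 ⊛ C → R ≗ recip (p 5) ⊛ C
quotient R C e = ≗-trans (≗-sym (recip-cancel (p 5) R refl))
  (⊛-congˡ (recip (p 5)) (⊛-cancelˡ (p 1 ⊛ p 2 ⊛ p 3 ⊛ p 4) {p 5 ⊛ R} {C} refl e))

dissected : ∀ R → p 1 ⊛ p 2 ⊛ p 3 ⊛ p 4 ⊛ (p 5 ⊛ R) ≗ poch∞ q q ⊛ R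
dissected R = ≗-trans (≗-sym (⊛-assoc (p 1 ⊛ p 2 ⊛ p 3 ⊛ p 4) (p 5) R)) (⊛-congʳ R (≗-sym poch∞-dissect))

rogers-0-cp : rogers 0 ≗ recip (p 5) ⊛ cpSeries 1 4 5
rogers-0-cp = quotient (rogers 0) C (begin
  p 1 ⊛ p 2 ⊛ p 3 ⊛ p 4 ⊛ (p 5 ⊛ rogers 0)  ≈⟨ dissected (rogers 0) ⟩
  poch∞ q q ⊛ rogers 0                      ≈⟨ rogers-0-product ⟩
  p 3 ⊛ p 2 ⊛ p 5                           ≈⟨ ⊛-congˡ (p 3 ⊛ p 2) (cpSeries-complementary 1 4 (s≤s z≤n) (s≤s z≤n) refl) ⟨
  p 3 ⊛ p 2 ⊛ (p 1 ⊛ p 4 ⊛ C)               ≈⟨ solve 5 (λ a b c d C → c :* b :* (a :* d :* C) := a :* b :* c :* d :* C) ≗-refl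
                                                 (p 1) (p 2) (p 3) (p 4) C ⟩
  p 1 ⊛ p 2 ⊛ p 3 ⊛ p 4 ⊛ C                 ∎)
  where
  open ≗-Reasoning
  C = cpSeries 1 4 5

rogers-1-cp : rogers 1 ≗ recip (p 5) ⊛ cpSeries 2 3 5
rogers-1-cp = quotient (rogers 1) C (begin
  p 1 ⊛ p 2 ⊛ p 3 ⊛ p 4 ⊛ (p 5 ⊛ rogers 1)  ≈⟨ dissected (rogers 1) ⟩
  poch∞ q q ⊛ rogers 1                      ≈⟨ rogers-1-product ⟩
  p 4 ⊛ p 1 ⊛ p 5                           ≈⟨ ⊛-congˡ (p 4 ⊛ p 1) (cpSeries-complementary 2 3 (s≤s z≤n) (s≤s z≤n) refl) ⟨
  p 4 ⊛ p 1 ⊛ (p 2 ⊛ p 3 ⊛ C)               ≈⟨ solve 5 (λ a b c d C → d :* a :* (b :* c :* C) := a :* b :* c :* d :* C) ≗-refl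
                                                 (p 1) (p 2) (p 3) (p 4) C ⟩
  p 1 ⊛ p 2 ⊛ p 3 ⊛ p 4 ⊛ C                 ∎)
  where
  open ≗-Reasoning
  C = cpSeries 2 3 5

corollary4p3 : (G ≗ recip (poch∞ (q ↑ 5) (q ↑ 5)) ⊛ cpSeries 1 4 5) ×
    (H ≗ recip (poch∞ (q ↑ 5) (q ↑ 5)) ⊛ cpSeries 2 3 5)
corollary4p3 = ≗-trans (Σ∞-cong (λ n → exponent n (sym (ℕₚ.+-identityʳ (n ℕ.* n))))) rogers-0-cp ,
               ≗-trans (Σ∞-cong (λ n → exponent n (cong (n ℕ.* n ℕ.+_) (sym (ℕₚ.*-identityˡ n))))) rogers-1-cp
  where
  exponent : ∀ {d e} n → d ≡ e → q ↑ d ⊛ recip (poch q q n) ≗ q ↑ e ⊛ recip (poch q q n)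
  exponent n refl = ≗-refl
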